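{- Let $m \ge 1$ be odd and $n \ge 4$ be even. The honeycomb toroidal graph $\mathrm{HTG}(m,n,3)$ is 2-spanning cyclable if and only if one of the following holds: (i) $m=1$, $n \equiv 0 \pmod 4$ and $n > 6$; (ii) $m \geq 5$ and $n = 6$; (iii) $m \geq 3$ and $n \geq 8$.
   Context: For integers $m\ge 1$, $\ell\ge 0$ and $n\ge 4$ with $n$ even and $m-\ell$ even, the honeycomb toroidal graph $\mathrm{HTG}(m,n,\ell)$ is the simple graph with vertex set $\{u_{i,j}: 0\le i\le m-1,\ 0\le j\le n-1\}$ (first subscript computed modulo $m$, second modulo $n$) whose edge set is the set of the following unordered pairs: $\{u_{i,j},u_{i,j+1}\}$ for all $i,j$ (vertical edges); $\{u_{i,j},u_{i+1,j}\}$ for all $0\le i\le m-2$ with $i+j$ odd (flat edges); and $\{u_{m-1,j},u_{0,j+\ell}\}$ for all $j$ having the same parity as $m$ (and $\ell$) (jump edges). (Repeated pairs give a single edge.) A 2-factor of a graph is a spanning subgraph in which every vertex has valency 2. A graph $X$ is 2-spanning cyclable if for every pair of distinct vertices $u,v$ of $X$ there is a 2-factor of $X$ consisting of exactly two cycles such that $u$ and $v$ lie in different cycles. -}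

module Defs where

open import Data.Nat using (ℕ; zero; suc; _+_; _*_; _%_; _≤_)
open import Data.Fin using (Fin; toℕ)
open import Data.Product using (_×_; Σ; ∃; _,_)
open import Data.Sum using (_⊎_)
open import Data.Unit using (⊤)
open import Data.Empty using (⊥)
open import Data.List using (List; []; _∷_; _++_; length)
open import Data.List.Membership.Propositional using (_∈_)
open import Data.List.Relation.Unary.Unique.Propositional using (Unique)
open import Relation.Binary.PropositionalEquality using (_≡_; _≢_)

CongMod : ℕ → ℕ → ℕ → Set
CongMod n a b = ∃ λ q → (a ≡ b + q * n) ⊎ (b ≡ a + q * n)

Vertex : ℕ → ℕ → Set
Vertex m n = Fin m × Fin n

module _ (m n ℓ : ℕ) where
  VertE : ℕ → ℕ → ℕ → ℕ → Set
  VertE i j i' j' = i ≡ i' × (CongMod n j' (j + 1) ⊎ CongMod n j (j' + 1))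

  FlatE : ℕ → ℕ → ℕ → ℕ → Set
  FlatE i j i' j' = j ≡ j' ×
    ((suc i ≡ i' × (i + j) % 2 ≡ 1) ⊎ (suc i' ≡ i × (i' + j') % 2 ≡ 1))

  JumpE : ℕ → ℕ → ℕ → ℕ → Set
  JumpE i j i' j' =
      (suc i ≡ m × i' ≡ 0 × j % 2 ≡ m % 2 × CongMod n j' (j + ℓ))
    ⊎ (suc i' ≡ m × i ≡ 0 × j' % 2 ≡ m % 2 × CongMod n j (j' + ℓ))

  HTGAdj : Vertex m n → Vertex m n → Set
  HTGAdj (i , j) (i' , j') =
    (i , j) ≢ (i' , j') ×
    (VertE (toℕ i) (toℕ j) (toℕ i') (toℕ j')
     ⊎ FlatE (toℕ i) (toℕ j) (toℕ i') (toℕ j')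
     ⊎ JumpE (toℕ i) (toℕ j) (toℕ i') (toℕ j'))

module _ {V : Set} (Adj : V → V → Set) where
  Walk : List V → Set
  Walk [] = ⊤
  Walk (x ∷ []) = ⊤
  Walk (x ∷ y ∷ rest) = Adj x y × Walk (y ∷ rest)

  IsCycle : List V → Set
  IsCycle [] = ⊥
  IsCycle (x ∷ xs) = 3 ≤ length (x ∷ xs) × Unique (x ∷ xs) × Walk (x ∷ xs ++ x ∷ [])

  TwoCycleFactor : List V → List V → Set
  TwoCycleFactor C₁ C₂ =
    IsCycle C₁ × IsCycle C₂ ×
    (∀ w → w ∈ C₁ ⊎ w ∈ C₂) × (∀ w → w ∈ C₁ → w ∈ C₂ → ⊥)

  TwoSpanningCyclable : Set
  TwoSpanningCyclable = ∀ u v → u ≢ v →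
    Σ (List V) λ C₁ → Σ (List V) λ C₂ → TwoCycleFactor C₁ C₂ × u ∈ C₁ × v ∈ C₂

{-# OPTIONS --safe #-}
module Submission where

open import Defs
open import Data.Bool using (Bool; true; false; if_then_else_; not)
import Data.Bool.Properties as Bool
open import Data.Empty using (⊥; ⊥-elim)
open import Data.Fin using (Fin; zero; suc; fromℕ; inject₁; toℕ; combine; remQuot)
open import Data.Fin.Induction using (<-weakInduction; >-weakInduction)
import Data.Fin.Properties as Fin
open import Data.Fin.Relation.Unary.Top using (view; ‵fromℕ; ‵inject₁; view-fromℕ; view-inject₁)
open import Data.List using (List; []; _∷_; _++_; length; map)
import Data.List as List
import Data.List.Membership.DecPropositional as DecMembership
open import Data.List.Membership.Propositional using (_∈_; _∉_)
open import Data.List.Membership.Propositional.Properties using (∈-map⁺; ∈-map⁻; ∈-lookup; ∈-++⁺ˡ; ∈-++⁺ʳ; ∈-++⁻)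
import Data.List.Properties as List
open import Data.List.Relation.Unary.All using (All; []; _∷_; all?)
open import Data.List.Relation.Unary.All.Properties using (¬Any⇒All¬; All¬⇒¬Any)
open import Data.List.Relation.Unary.AllPairs using ([]; _∷_)
open import Data.List.Relation.Unary.Any using (Any; here; there; any?)
open import Data.List.Relation.Unary.Unique.Propositional using (Unique)
import Data.List.Relation.Unary.Unique.Propositional.Properties as Unique
open import Data.Nat using (ℕ; zero; suc; _+_; _*_; _%_; _/_; _≤_; _<_; z≤n; s≤s)
open import Data.Nat.DivMod using (m≡m%n+[m/n]*n; [m+n]%n≡m%n; [m+kn]%n≡m%n; m<n⇒m%n≡m)
import Data.Nat.Properties as ℕ
open import Data.Nat.Tactic.RingSolver using (solve-∀)
open import Data.Product using (_×_; _,_; Σ; ∃; proj₁; proj₂)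
open import Data.Product.Properties using (≡-dec)
open import Data.Sum using (_⊎_; inj₁; inj₂; [_,_]′)
open import Data.Unit using (tt)
open import Data.Vec using (Vec; []; _∷_; lookup)
open import Function using (_∘_; id)
open import Function.Bundles using (_⇔_; mk⇔; Equivalence)
open import Relation.Binary.Construct.Closure.ReflexiveTransitive using (Star; ε; _◅_; _◅◅_; gmap; reverse; kleisliStar)
open import Relation.Binary.Definitions using (DecidableEquality)
open import Relation.Binary.PropositionalEquality
open import Relation.Nullary using (¬_; Dec; yes; no)
open import Relation.Nullary.Decidable using (¬?; map′; _×-dec_; _⊎-dec_; from-yes; decidable-stable)
open ≡-Reasoning

-- A 2-factor of a cubic graph is the complement of a perfect matching. In HTG(m, n, ℓ) two columns can be
-- inserted anywhere: if a 2-factor crosses a cut between two columns, then each crossing edge is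
-- prolonged by a detour through the new columns which goes up to the next crossing edge and back, so
-- that the cycles persist. For m ≥ 3 a factor with two cycles crosses every cut. Since HTG(3, n, 3) is
-- also a honeycomb torus with n / 2 columns of length 6, read along another lattice direction, inserting
-- columns twice reduces all cases with m ≥ 3 to the tori with 4 or 5 columns of length 6, which are
-- settled by explicit factors. For m = 1 an explicit 4-cycle, together with the factor omitting one class
-- of parallel edges when 4 divides n, suffices. In the exceptional cases the endpoints of a suitable edge
-- are never separated, except that HTG(3, 6, 3), the Pappus graph, has no 2-factor with two cycles.

-- A 2-factor is kept as an omitted direction at every vertex, because inserting columns then
-- changes it only locally. Lists of vertices occur only in the passage to and from the statement,
-- where parallel edges have to be excluded. In sheared coordinates a torus is given by its numbers
-- of columns and rows and by one twist `K` that glues the last column to the first. For m = 2h + 1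
-- and jump 3 the twist is the shift by h + 2. A detour through two new columns comes out one row
-- below its entry, so insertion passes from the twist `p` ∘ `K` to the twist `K`. This is why the
-- jump 3 persists when m grows by 2, and why the tori with three rows must be treated for all
-- twists together. There the induction cannot begin with three columns: with the identity twist
-- that torus is the Pappus graph. Since columns come in pairs, both 4 and 5 are needed as starting
-- values.

-- Directions, edge-coloured cubic graphs and their 2-factors

data Dir : Set where
  α β γ : Dir

data Side : Set where
  src tgt : Side

infix 4 _≟ᵈ_
_≟ᵈ_ : DecidableEquality Dir
α ≟ᵈ α = yes refl
α ≟ᵈ β = no λ ()
α ≟ᵈ γ = no λ ()
β ≟ᵈ α = no λ ()
β ≟ᵈ β = yes refl
β ≟ᵈ γ = no λ ()
γ ≟ᵈ α = no λ ()
γ ≟ᵈ β = no λ ()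
γ ≟ᵈ γ = yes refl

-- The diagonal values are an arbitrary choice of a direction other than the argument: `third d d`
-- is the direction in which a walk sets out from a vertex that omits `d`.
third : Dir → Dir → Dir
third α α = β
third α β = γ
third α γ = β
third β α = γ
third β β = α
third β γ = α
third γ α = β
third γ β = α
third γ γ = α

third-≢ˡ : ∀ d e → third d e ≢ d
third-≢ˡ α α ()
third-≢ˡ α β ()
third-≢ˡ α γ ()
third-≢ˡ β α ()
third-≢ˡ β β ()
third-≢ˡ β γ ()
third-≢ˡ γ α ()
third-≢ˡ γ β ()
third-≢ˡ γ γ ()

third-≢ʳ : ∀ d e → third d e ≢ e
third-≢ʳ α α ()
third-≢ʳ α β ()
third-≢ʳ α γ ()
third-≢ʳ β α ()
third-≢ʳ β β ()
third-≢ʳ β γ ()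
third-≢ʳ γ α ()
third-≢ʳ γ β ()
third-≢ʳ γ γ ()

third-unique : ∀ d e f → d ≢ e → f ≢ d → f ≢ e → f ≡ third d e
third-unique α α f d≢e _ _ = ⊥-elim (d≢e refl)
third-unique β β f d≢e _ _ = ⊥-elim (d≢e refl)
third-unique γ γ f d≢e _ _ = ⊥-elim (d≢e refl)
third-unique α β α _ f≢d _ = ⊥-elim (f≢d refl)
third-unique α β β _ _ f≢e = ⊥-elim (f≢e refl)
third-unique α β γ _ _ _ = refl
third-unique α γ α _ f≢d _ = ⊥-elim (f≢d refl)
third-unique α γ β _ _ _ = refl
third-unique α γ γ _ _ f≢e = ⊥-elim (f≢e refl)
third-unique β α α _ _ f≢e = ⊥-elim (f≢e refl)
third-unique β α β _ f≢d _ = ⊥-elim (f≢d refl)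
third-unique β α γ _ _ _ = refl
third-unique β γ α _ _ _ = refl
third-unique β γ β _ f≢d _ = ⊥-elim (f≢d refl)
third-unique β γ γ _ _ f≢e = ⊥-elim (f≢e refl)
third-unique γ α α _ _ f≢e = ⊥-elim (f≢e refl)
third-unique γ α β _ _ _ = refl
third-unique γ α γ _ f≢d _ = ⊥-elim (f≢d refl)
third-unique γ β α _ _ _ = refl
third-unique γ β β _ _ f≢e = ⊥-elim (f≢e refl)
third-unique γ β γ _ f≢d _ = ⊥-elim (f≢d refl)

-- A bipartite cubic graph whose edges are properly coloured by Dir: the source x is joined in direction
-- d to the target to d x.
record Graph : Set₁ where
  field
    A       : Set
    to from : Dir → A → A
    to-from : ∀ d x → to d (from d x) ≡ x
    from-to : ∀ d x → from d (to d x) ≡ x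

  V : Set
  V = Side × A

  nbr : Dir → V → V
  nbr d (src , x) = tgt , to d x
  nbr d (tgt , x) = src , from d x

  nbr-invol : ∀ d v → nbr d (nbr d v) ≡ v
  nbr-invol d (src , x) = cong (src ,_) (from-to d x)
  nbr-invol d (tgt , x) = cong (tgt ,_) (to-from d x)

  nbr-irrefl : ∀ d v → nbr d v ≢ v
  nbr-irrefl d (src , x) ()
  nbr-irrefl d (tgt , x) ()

  -- Parallel edges do arise in tori with few rows and columns. Without them a list of vertices
  -- determines the directions of its edges.
  Simple : Set
  Simple = ∀ {d e} v → nbr d v ≡ nbr e v → d ≡ e

  data Used (omit : V → Dir) : V → V → Set where
    use : ∀ {v} d → d ≢ omit v → Used omit v (nbr d v)

  Linked : (V → Dir) → V → V → Set
  Linked omit = Star (Used omit)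

  colour-invariant : (omit : V → Dir) (colour : V → Bool) →
    (∀ v d → d ≢ omit v → colour (nbr d v) ≡ colour v) → ∀ {v w} → Linked omit v w → colour v ≡ colour w
  colour-invariant omit colour inv ε = refl
  colour-invariant omit colour inv (use {v} d d≢ ◅ r) =
    trans (sym (inv v d d≢)) (colour-invariant omit colour inv r)

  module Matching (omit : V → Dir) (omit-nbr : ∀ v → omit (nbr (omit v) v) ≡ omit v) where

    -- Otherwise the matching edge at `nbr d v` would be the one leading back to `v`, and `v` would
    -- omit `d` as well.
    omit-back : ∀ {d v} → d ≢ omit v → d ≢ omit (nbr d v)
    omit-back {d} {v} d≢ d≡ = d≢ (begin
      d                              ≡⟨ d≡ ⟩
      omit (nbr d v)                 ≡⟨ omit-nbr (nbr d v) ⟨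
      omit (nbr (omit (nbr d v)) (nbr d v)) ≡⟨ cong (λ e → omit (nbr e (nbr d v))) d≡ ⟨
      omit (nbr d (nbr d v))         ≡⟨ cong omit (nbr-invol d v) ⟩
      omit v                         ∎)

    used-sym : ∀ {v w} → Used omit v w → Used omit w v
    used-sym (use {v} d d≢) = subst (Used omit (nbr d v)) (nbr-invol d v) (use d (omit-back d≢))

    linked-sym : ∀ {v w} → Linked omit v w → Linked omit w v
    linked-sym = reverse used-sym

-- The complement of a 2-factor of a cubic graph is a perfect matching, which is recorded by the
-- direction omitted at each vertex; the colouring singles out the two cycles.
record TwoCycles (G : Graph) : Set where
  open Graph G
  field
    omit       : V → Dir
    omit-nbr   : ∀ v → omit (nbr (omit v) v) ≡ omit v
    colour     : V → Bool
    colour-nbr : ∀ v d → d ≢ omit v → colour (nbr d v) ≡ colour v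
    linked     : ∀ v w → colour v ≡ colour w → Linked omit v w

  open Matching omit omit-nbr public

  linked-colour : ∀ {v w} → Linked omit v w → colour v ≡ colour w
  linked-colour = colour-invariant omit colour colour-nbr

-- Separation of vertices, isomorphisms and translations

Separable : (G : Graph) → Graph.V G → Graph.V G → Set
Separable G u v = Σ (TwoCycles G) λ F → TwoCycles.colour F u ≢ TwoCycles.colour F v

AllSeparable : Graph → Set
AllSeparable G = ∀ u v → u ≢ v → Separable G u v

-- Sides may be exchanged and directions permuted, which translations do not need but `quarter-turn`
-- does.
record Iso (G H : Graph) : Set where
  private
    module G = Graph G
    module H = Graph H
  field
    f     : G.V → H.V
    g     : H.V → G.V
    g-f   : ∀ v → g (f v) ≡ v
    f-g   : ∀ w → f (g w) ≡ w
    π π⁻  : Dir → Dir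
    π⁻-π  : ∀ d → π⁻ (π d) ≡ d
    π-π⁻  : ∀ d → π (π⁻ d) ≡ d
    f-nbr : ∀ d v → f (G.nbr d v) ≡ H.nbr (π d) (f v)

  f-injective : ∀ {u v} → f u ≡ f v → u ≡ v
  f-injective {u} {v} eq = trans (sym (g-f u)) (trans (cong g eq) (g-f v))

  pullback : TwoCycles H → TwoCycles G
  pullback F = record
    { omit       = omit′
    ; omit-nbr   = λ v → cong π⁻ (trans (cong omit (trans (f-nbr _ v) (cong (λ e → H.nbr e (f v)) (π-π⁻ _)))) (omit-nbr (f v)))
    ; colour     = λ v → colour (f v)
    ; colour-nbr = λ v d d≢ → trans (cong colour (f-nbr d v))
                     (colour-nbr (f v) (π d) λ eq → d≢ (trans (sym (π⁻-π d)) (cong π⁻ eq)))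
    ; linked     = λ v w eq → subst₂ (G.Linked omit′) (g-f v) (g-f w) (gmap g used (linked (f v) (f w) eq))
    }
    where
    open TwoCycles F
    omit′ : G.V → Dir
    omit′ v = π⁻ (omit (f v))
    g-nbr : ∀ d w → G.nbr (π⁻ d) (g w) ≡ g (H.nbr d w)
    g-nbr d w = f-injective (begin
      f (G.nbr (π⁻ d) (g w))       ≡⟨ f-nbr (π⁻ d) (g w) ⟩
      H.nbr (π (π⁻ d)) (f (g w))   ≡⟨ cong₂ H.nbr (π-π⁻ d) (f-g w) ⟩
      H.nbr d w                    ≡⟨ f-g _ ⟨
      f (g (H.nbr d w))            ∎)
    used : ∀ {v w} → H.Used omit v w → G.Used omit′ (g v) (g w)
    used (H.use {v} d d≢) = subst (G.Used omit′ (g v)) (g-nbr d v) (G.use (π⁻ d) λ eq →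
      d≢ (trans (sym (π-π⁻ d)) (trans (cong π eq) (trans (π-π⁻ _) (cong omit (f-g v))))))

  separable : ∀ {u v} → Separable H (f u) (f v) → Separable G u v
  separable (F , ≢) = pullback F , ≢

  allSeparable : AllSeparable H → AllSeparable G
  allSeparable all u v u≢v = separable (all (f u) (f v) (u≢v ∘ f-injective))

module Translation (G : Graph)
  (to-comm : ∀ d e x → Graph.to G d (Graph.to G e x) ≡ Graph.to G e (Graph.to G d x)) where
  open Graph G

  to-from-comm : ∀ d e x → to d (from e x) ≡ from e (to d x)
  to-from-comm d e x = begin
    to d (from e x)               ≡⟨ from-to e _ ⟨
    from e (to e (to d (from e x))) ≡⟨ cong (from e) (to-comm e d _) ⟩
    from e (to d (to e (from e x))) ≡⟨ cong (from e ∘ to d) (to-from e x) ⟩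
    from e (to d x)               ∎

  translation : Dir → Iso G G
  translation e = record
    { f = λ (b , x) → b , to e x
    ; g = λ (b , x) → b , from e x
    ; g-f = λ (b , x) → cong (b ,_) (from-to e x)
    ; f-g = λ (b , x) → cong (b ,_) (to-from e x)
    ; π = λ d → d
    ; π⁻ = λ d → d
    ; π⁻-π = λ d → refl
    ; π-π⁻ = λ d → refl
    ; f-nbr = λ { d (src , x) → cong (tgt ,_) (to-comm e d x) ; d (tgt , x) → cong (src ,_) (to-from-comm e d x) }
    }

-- Cyclic shifts of the rows

s p : ∀ {n} → Fin (suc n) → Fin (suc n)
s i with view i
... | ‵fromℕ     = zero
... | ‵inject₁ j = suc j
p zero    = fromℕ _
p (suc i) = inject₁ i

s-fromℕ : ∀ n → s (fromℕ n) ≡ zero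
s-fromℕ n rewrite view-fromℕ n = refl

s-inject₁ : ∀ {n} (i : Fin n) → s (inject₁ i) ≡ suc i
s-inject₁ i rewrite view-inject₁ i = refl

s-p : ∀ {n} (i : Fin (suc n)) → s (p i) ≡ i
s-p zero    = s-fromℕ _
s-p (suc i) = s-inject₁ i

p-s : ∀ {n} (i : Fin (suc n)) → p (s i) ≡ i
p-s i with view i
... | ‵fromℕ     = refl
... | ‵inject₁ j = refl

-- Climbing from row `i` to the top and wrapping round reaches row 0, from which ordinary induction
-- covers every row.
cyclic-induction : ∀ {n} (P : Fin (suc n) → Set) → ∀ {i} → P i → (∀ j → P j → P (s j)) → ∀ j → P j
cyclic-induction P {i} Pi step =
  <-weakInduction P (to-zero i Pi) λ j Pj → subst P (s-inject₁ j) (step _ Pj)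
  where
  to-zero : ∀ j → P j → P zero
  to-zero = >-weakInduction (λ j → P j → P zero)
    (λ Pj → subst P (s-fromℕ _) (step _ Pj))
    (λ j ih Pj → ih (subst P (s-inject₁ j) (step _ Pj)))

cyclic-coinduction : ∀ {n} (P : Fin (suc n) → Set) → ∀ {i} → P i → (∀ j → P (s j) → P j) → ∀ j → P j
cyclic-coinduction P {i} Pi step j =
  cyclic-induction (λ k → P k → P j) {j} id (λ k ih Psk → ih (step k Psk)) i Pi

-- Commuting with `s` forces `K` to be a power of `s`. The exponent is left out so that insertion
-- can replace `K` by `p` ∘ `K` without arithmetic.
record Twist (n : ℕ) : Set where
  field
    K K⁻ : Fin (suc n) → Fin (suc n)
    K-K⁻ : ∀ a → K (K⁻ a) ≡ a
    K⁻-K : ∀ a → K⁻ (K a) ≡ a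
    K-s  : ∀ a → K (s a) ≡ s (K a)

id-twist : ∀ {n} → Twist n
id-twist = record { K = id ; K⁻ = id ; K-K⁻ = λ _ → refl ; K⁻-K = λ _ → refl ; K-s = λ _ → refl }

s-twist p-twist : ∀ {n} → Twist n → Twist n
s-twist τ = record
  { K = s ∘ K ; K⁻ = K⁻ ∘ p
  ; K-K⁻ = λ a → trans (cong s (K-K⁻ (p a))) (s-p a)
  ; K⁻-K = λ a → trans (cong K⁻ (p-s (K a))) (K⁻-K a)
  ; K-s = λ a → cong s (K-s a) }
  where open Twist τ
p-twist τ = record
  { K = p ∘ K ; K⁻ = K⁻ ∘ s
  ; K-K⁻ = λ a → trans (cong p (K-K⁻ (s a))) (p-s a)
  ; K⁻-K = λ a → trans (cong K⁻ (s-p (K a))) (K⁻-K a)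
  ; K-s = λ a → trans (cong p (K-s a)) (trans (p-s (K a)) (sym (s-p (K a)))) }
  where open Twist τ

s-power : ∀ {n} → ℕ → Twist n
s-power zero    = id-twist
s-power (suc k) = s-twist (s-power k)

-- Twisted tori

module _ (m : ℕ) {n : ℕ} (τ : Twist n) where
  open Twist τ

  hop hop⁻ : Fin (suc m) × Fin (suc n) → Fin (suc m) × Fin (suc n)
  hop (c , a) with view c
  ... | ‵fromℕ     = zero , K a
  ... | ‵inject₁ j = suc j , a
  hop⁻ (zero , a)  = fromℕ m , K⁻ a
  hop⁻ (suc c , a) = inject₁ c , a

  hop-fromℕ : ∀ a → hop (fromℕ m , a) ≡ (zero , K a)
  hop-fromℕ a rewrite view-fromℕ m = refl

  hop-inject₁ : ∀ c a → hop (inject₁ c , a) ≡ (suc c , a)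
  hop-inject₁ c a rewrite view-inject₁ c = refl

  hop-hop⁻ : ∀ x → hop (hop⁻ x) ≡ x
  hop-hop⁻ (zero , a)  = trans (hop-fromℕ (K⁻ a)) (cong (zero ,_) (K-K⁻ a))
  hop-hop⁻ (suc c , a) = hop-inject₁ c a

  hop⁻-hop : ∀ x → hop⁻ (hop x) ≡ x
  hop⁻-hop (c , a) with view c
  ... | ‵fromℕ     = cong (fromℕ m ,_) (K⁻-K a)
  ... | ‵inject₁ j = refl

  lift : (Fin (suc n) → Fin (suc n)) → Fin (suc m) × Fin (suc n) → Fin (suc m) × Fin (suc n)
  lift h (c , a) = c , h a

  hop-s : ∀ x → hop (lift s x) ≡ lift s (hop x)
  hop-s (c , a) with view c
  ... | ‵fromℕ     = cong (zero ,_) (K-s a)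
  ... | ‵inject₁ j = refl

  -- HTG(m+1, 2(n+1), ℓ) in coordinates sheared so that its even translations become the translations
  -- of the torus; K is the translation by (m + 1 + ℓ)/2.
  Torus : Graph
  Torus = record { A = Fin (suc m) × Fin (suc n) ; to = to ; from = from ; to-from = to-from ; from-to = from-to }
    where
    to from : Dir → Fin (suc m) × Fin (suc n) → Fin (suc m) × Fin (suc n)
    to α = id
    to β = lift s
    to γ = hop
    from α = id
    from β = lift p
    from γ = hop⁻
    to-from : ∀ d x → to d (from d x) ≡ x
    to-from α x = refl
    to-from β (c , a) = cong (c ,_) (s-p a)
    to-from γ = hop-hop⁻
    from-to : ∀ d x → from d (to d x) ≡ x
    from-to α x = refl
    from-to β (c , a) = cong (c ,_) (p-s a)
    from-to γ = hop⁻-hop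

  to-comm : ∀ d e x → Graph.to Torus d (Graph.to Torus e x) ≡ Graph.to Torus e (Graph.to Torus d x)
  to-comm α e x = refl
  to-comm β α x = refl
  to-comm γ α x = refl
  to-comm β β x = refl
  to-comm β γ x = sym (hop-s x)
  to-comm γ β x = hop-s x
  to-comm γ γ x = refl

  column : Graph.V Torus → Fin (suc m)
  column (_ , c , _) = c

open Translation using (translation)

torus-translation : ∀ m {n} (τ : Twist n) → Dir → Iso (Torus m τ) (Torus m τ)
torus-translation m τ = translation (Torus m τ) (to-comm m τ)

torus-cong : ∀ m {n} (τ σ : Twist n) → (∀ a → Twist.K τ a ≡ Twist.K σ a) → Iso (Torus m τ) (Torus m σ)
torus-cong m τ σ eq = record
  { f = id ; g = id ; g-f = λ _ → refl ; f-g = λ _ → refl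
  ; π = id ; π⁻ = id ; π⁻-π = λ _ → refl ; π-π⁻ = λ _ → refl
  ; f-nbr = λ { d (src , x) → cong (tgt ,_) (to-eq d x) ; d (tgt , x) → cong (src ,_) (from-eq d x) } }
  where
  module T = Twist τ
  module S = Twist σ
  to-eq : ∀ d x → Graph.to (Torus m τ) d x ≡ Graph.to (Torus m σ) d x
  to-eq α x = refl
  to-eq β x = refl
  to-eq γ (c , a) with view c
  ... | ‵fromℕ     = cong (zero ,_) (eq a)
  ... | ‵inject₁ j = refl
  from-eq : ∀ d x → Graph.from (Torus m τ) d x ≡ Graph.from (Torus m σ) d x
  from-eq α x = refl
  from-eq β x = refl
  from-eq γ (zero , a) = cong (fromℕ m ,_) (begin
    T.K⁻ a                   ≡⟨ S.K⁻-K _ ⟨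
    S.K⁻ (S.K (T.K⁻ a))      ≡⟨ cong S.K⁻ (eq _) ⟨
    S.K⁻ (T.K (T.K⁻ a))      ≡⟨ cong S.K⁻ (T.K-K⁻ a) ⟩
    S.K⁻ a                   ∎)
  from-eq γ (suc c , a) = refl

-- Insertion of two columns

bool-pigeonhole : (x y z : Bool) → x ≡ y ⊎ y ≡ z ⊎ x ≡ z
bool-pigeonhole false false z     = inj₁ refl
bool-pigeonhole true  true  z     = inj₁ refl
bool-pigeonhole false true  true  = inj₂ (inj₁ refl)
bool-pigeonhole true  false false = inj₂ (inj₁ refl)
bool-pigeonhole false true  false = inj₂ (inj₂ refl)
bool-pigeonhole true  false true  = inj₂ (inj₂ refl)

module _ {m n : ℕ} {τ : Twist n} (F : TwoCycles (Torus m τ)) where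
  open Graph (Torus m τ)
  open TwoCycles F

  omit-partner : ∀ {v d} → omit v ≡ d → omit (nbr d v) ≡ d
  omit-partner {v} refl = omit-nbr v

  -- A source omitting `α` or `β` would be matched with a target of its own column, and those are
  -- all matched by `γ`.
  src-omits-γ : ∀ c → (∀ b → omit (tgt , c , b) ≡ γ) → ∀ b → omit (src , c , b) ≡ γ
  src-omits-γ c all b with omit (src , c , b) in eq
  ... | α = trans (sym (omit-partner eq)) (all b)
  ... | β = trans (sym (omit-partner eq)) (all (s b))
  ... | γ = refl

  tgt-omits-γ : (∀ b → omit (tgt , zero , b) ≡ γ) → ∀ c b → omit (tgt , c , b) ≡ γ
  tgt-omits-γ all = <-weakInduction _ all λ c ih b →
    trans (cong (λ x → omit (tgt , x)) (sym (hop-inject₁ m τ c b))) (omit-partner (src-omits-γ (inject₁ c) ih b))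

-- Otherwise every column is a cycle of its own, and there are at least three of them.
cut-is-crossed : ∀ {m n} {τ : Twist n} (F : TwoCycles (Torus (suc (suc m)) τ)) →
  ∃ λ b → TwoCycles.omit F (tgt , zero , b) ≢ γ
cut-is-crossed {m} {n} {τ} F
  with Fin.any? (λ b → ¬? (TwoCycles.omit F (tgt , zero , b) ≟ᵈ γ))
... | yes crossed = crossed
... | no uncrossed = ⊥-elim (contra (bool-pigeonhole (colour (v zero)) (colour (v (suc zero))) (colour (v (suc (suc zero))))))
  where
  open Graph (Torus (suc (suc m)) τ)
  open TwoCycles F
  omits-γ : ∀ v → omit v ≡ γ
  omits-γ (tgt , c , b) = tgt-omits-γ F (λ b → decidable-stable (_ ≟ᵈ γ) λ ≢γ → uncrossed (b , ≢γ)) c b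
  omits-γ (src , c , b) = src-omits-γ F c (λ b → omits-γ (tgt , c , b)) b
  same-column : ∀ {v w} → Linked omit v w → column _ τ v ≡ column _ τ w
  same-column ε = refl
  same-column (use {src , _} α _ ◅ r) = same-column r
  same-column (use {src , _} β _ ◅ r) = same-column r
  same-column (use {tgt , _} α _ ◅ r) = same-column r
  same-column (use {tgt , _} β _ ◅ r) = same-column r
  same-column (use {v} γ γ≢ ◅ r) = ⊥-elim (γ≢ (sym (omits-γ v)))
  v : Fin (suc (suc (suc m))) → V
  v c = src , c , zero
  contra : _ → ⊥
  contra (inj₁ eq) with () ← same-column (linked (v _) (v _) eq)
  contra (inj₂ (inj₁ eq)) with () ← same-column (linked (v _) (v _) eq)
  contra (inj₂ (inj₂ eq)) with () ← same-column (linked (v _) (v _) eq)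

-- Two new columns 0 and 1 are inserted in front of the old column 0. Between consecutive rows where a
-- cycle crosses the cut, it now runs up column 0 and back down column 1.
module Insertion (m : ℕ) {n : ℕ} (τ : Twist n)
                 (F : TwoCycles (Torus m (p-twist τ)))
                 (crossed : ∃ λ b → TwoCycles.omit F (tgt , zero , b) ≢ γ) where
  open Twist τ
  private
    module G = Graph (Torus m (p-twist τ))
    module H = Graph (Torus (suc (suc m)) τ)
  open TwoCycles F

  Row : Set
  Row = Fin (suc n)

  crosses : Row → Bool
  crosses b with omit (tgt , zero , b)
  ... | α = true
  ... | β = true
  ... | γ = false

  crosses-true : ∀ {b} → crosses b ≡ true → omit (tgt , zero , b) ≢ γ
  crosses-true {b} _ eq with omit (tgt , zero , b)
  crosses-true () eq | γ

  crosses-false : ∀ {b} → crosses b ≡ false → omit (tgt , zero , b) ≡ γ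
  crosses-false {b} _ with omit (tgt , zero , b)
  crosses-false () | α
  crosses-false () | β
  crosses-false _  | γ = refl

  ≢γ⇒crosses : ∀ {b} → omit (tgt , zero , b) ≢ γ → crosses b ≡ true
  ≢γ⇒crosses {b} ≢γ with omit (tgt , zero , b)
  ... | α = refl
  ... | β = refl
  ... | γ = ⊥-elim (≢γ refl)

  -- The search downwards from a row is recorded as a derivation because the rows are cyclic: it
  -- ends only because some row is crossed.
  data LastCrossing (r : Row) : Row → Set where
    here  : crosses r ≡ true → LastCrossing r r
    above : ∀ {b} → crosses b ≡ false → LastCrossing r (p b) → LastCrossing r b

  last-crossing-unique : ∀ {r r′ b} → LastCrossing r b → LastCrossing r′ b → r ≡ r′
  last-crossing-unique (here _) (here _) = refl
  last-crossing-unique (here t) (above f _) with () ← trans (sym t) f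
  last-crossing-unique (above f _) (here t) with () ← trans (sym t) f
  last-crossing-unique (above _ l) (above _ l′) = last-crossing-unique l l′

  last-crossing : ∀ b → ∃ λ r → LastCrossing r b
  last-crossing = cyclic-induction _ (_ , here (≢γ⇒crosses (proj₂ crossed))) λ b (r , l) → step b r l (crosses (s b)) refl
    where
    step : ∀ b r → LastCrossing r b → ∀ x → crosses (s b) ≡ x → ∃ λ r → LastCrossing r (s b)
    step b r l true  eq = s b , here eq
    step b r l false eq = r , above eq (subst (LastCrossing r) (sym (p-s b)) l)

  rowColour : Row → Bool
  rowColour b = colour (tgt , zero , proj₁ (last-crossing b))

  rowColour-crossing : ∀ {b} → crosses b ≡ true → rowColour b ≡ colour (tgt , zero , b)
  rowColour-crossing t = cong (λ r → colour (tgt , zero , r)) (last-crossing-unique (proj₂ (last-crossing _)) (here t))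

  rowColour-p : ∀ {b} → crosses b ≡ false → rowColour b ≡ rowColour (p b)
  rowColour-p f = cong (λ r → colour (tgt , zero , r)) (last-crossing-unique (proj₂ (last-crossing _)) (above f (proj₂ (last-crossing _))))

  -- The edge that used to enter the old target in row b of column 0 now enters the new column 0 one
  -- row higher, whence `p b` in the second clause. A crossing row cuts the `β` edge going up in
  -- column 0 and the `α` edge in column 1; any other row cuts the `γ` edge between these columns.
  omit′ : H.V → Dir
  omit′ (x , suc (suc c) , b)   = omit (x , c , b)
  omit′ (tgt , zero , b)        = if crosses (p b) then β else γ
  omit′ (src , zero , b)        = if crosses b then β else γ
  omit′ (tgt , suc zero , b)    = if crosses b then α else γ
  omit′ (src , suc zero , b)    = if crosses b then α else γ

  -- For consecutive crossing rows r and r′, the detour of r meets the sources of column 1 in the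
  -- rows from r to r′ - 1, but the other three kinds of new vertices in the rows from r + 1 to r′.
  -- This accounts for `p b` in three clauses.
  colour′ : H.V → Bool
  colour′ (x , suc (suc c) , b) = colour (x , c , b)
  colour′ (tgt , zero , b)      = rowColour (p b)
  colour′ (src , zero , b)      = rowColour (p b)
  colour′ (tgt , suc zero , b)  = rowColour (p b)
  colour′ (src , suc zero , b)  = rowColour b

  ι : G.V → H.V
  ι (x , c , b) = x , suc (suc c) , b

  -- Indexed by the row in which its `γ` edge arrives in the new torus; in the old torus that edge
  -- arrives one row lower, at `p b`.
  last : Row → G.V
  last b = src , fromℕ m , K⁻ b

  -- The embedding `ι` preserves every edge except the `γ` edges over the cut; `left` and `right`
  -- mark the two ends of such an edge.
  data Position : G.V → Set where
    away  : ∀ {v} → H.nbr γ (ι v) ≡ ι (G.nbr γ v) → Position v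
    left  : ∀ b → Position (last b)
    right : ∀ b → Position (tgt , zero , b)

  position : ∀ v → Position v
  position (src , c , a) with view c in eq
  ... | ‵fromℕ     = subst (λ x → Position (src , fromℕ m , x)) (K⁻-K a) (left (K a))
  ... | ‵inject₁ j = away inner
    where
    inner : H.nbr γ (ι (src , inject₁ j , a)) ≡ ι (G.nbr γ (src , inject₁ j , a))
    inner rewrite view-inject₁ j = refl
  position (tgt , zero , a)  = right a
  position (tgt , suc c , a) = away refl

  nbr-last : ∀ b → G.nbr γ (last b) ≡ (tgt , zero , p b)
  nbr-last b = cong (tgt ,_) (trans (hop-fromℕ m (p-twist τ) (K⁻ b)) (cong (λ x → zero , p x) (K-K⁻ b)))

  nbr-last′ : ∀ b → H.nbr γ (ι (last b)) ≡ (tgt , zero , b)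
  nbr-last′ b = cong (tgt ,_) (trans (hop-fromℕ (suc (suc m)) τ (K⁻ b)) (cong (zero ,_) (K-K⁻ b)))

  crosses-left : ∀ b → crosses (p b) ≡ true → omit (last b) ≢ γ
  crosses-left b t eq = crosses-true t (trans (cong omit (sym (nbr-last b))) (omit-partner F eq))

  avoids-left : ∀ b → crosses (p b) ≡ false → omit (last b) ≡ γ
  avoids-left b f = trans (cong omit (sym (trans (cong (G.nbr γ) (sym (nbr-last b))) (G.nbr-invol γ (last b)))))
                          (omit-partner F (crosses-false f))

  crosses-left⁻ : ∀ b → omit (last b) ≢ γ → crosses (p b) ≡ true
  crosses-left⁻ b ≢γ with crosses (p b) in eq
  ... | true  = refl
  ... | false = ⊥-elim (≢γ (avoids-left b eq))

  omits-γ-left : ∀ b → omit (last b) ≡ γ → crosses (p b) ≡ false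
  omits-γ-left b eq with crosses (p b) in t
  ... | true  = ⊥-elim (crosses-left b t eq)
  ... | false = refl

  omits-γ-right : ∀ b → omit (tgt , zero , b) ≡ γ → crosses b ≡ false
  omits-γ-right b eq with crosses b in t
  ... | true  = ⊥-elim (crosses-true t eq)
  ... | false = refl

  omit-old : ∀ v d → omit v ≡ d → omit′ (H.nbr d (ι v)) ≡ d
  omit-old (src , _) α eq = omit-partner F eq
  omit-old (src , _) β eq = omit-partner F eq
  omit-old (tgt , _) α eq = omit-partner F eq
  omit-old (tgt , _) β eq = omit-partner F eq
  omit-old v γ eq with position v
  ... | away inner = trans (cong omit′ inner) (omit-partner F eq)
  ... | left b  rewrite nbr-last′ b | omits-γ-left b eq = refl
  ... | right b rewrite omits-γ-right b eq = refl

  omit-nbr′ : ∀ v → omit′ (H.nbr (omit′ v) v) ≡ omit′ v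
  omit-nbr′ (x , suc (suc c) , b) = omit-old (x , c , b) _ refl
  omit-nbr′ (src , zero , b) with crosses b in eq
  ... | true rewrite p-s b | eq = refl
  ... | false rewrite eq = refl
  omit-nbr′ (tgt , zero , b) with crosses (p b) in eq
  ... | true rewrite eq = refl
  ... | false = avoids-left b eq
  omit-nbr′ (src , suc zero , b) with crosses b in eq
  ... | true rewrite eq = refl
  ... | false = crosses-false eq
  omit-nbr′ (tgt , suc zero , b) with crosses b in eq
  ... | true rewrite eq = refl
  ... | false rewrite eq = refl

  colour-nbr′ : ∀ v d → d ≢ omit′ v → colour′ (H.nbr d v) ≡ colour′ v
  colour-nbr′ (src , suc (suc c) , b) α d≢ = colour-nbr (src , c , b) α d≢
  colour-nbr′ (src , suc (suc c) , b) β d≢ = colour-nbr (src , c , b) β d≢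
  colour-nbr′ (tgt , suc (suc c) , b) α d≢ = colour-nbr (tgt , c , b) α d≢
  colour-nbr′ (tgt , suc (suc c) , b) β d≢ = colour-nbr (tgt , c , b) β d≢
  colour-nbr′ (x , suc (suc c) , b) γ d≢ = old (x , c , b) d≢
    where
    old : ∀ v → γ ≢ omit v → colour′ (H.nbr γ (ι v)) ≡ colour v
    old v d≢ with position v
    ... | away inner = trans (cong colour′ inner) (colour-nbr v γ d≢)
    ... | left b = trans (cong colour′ (nbr-last′ b)) (trans (rowColour-crossing (crosses-left⁻ b (d≢ ∘ sym)))
                     (trans (cong colour (sym (nbr-last b))) (colour-nbr v γ d≢)))
    ... | right b = rowColour-crossing (≢γ⇒crosses (d≢ ∘ sym))
  colour-nbr′ (src , zero , b) α d≢ = refl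
  colour-nbr′ (src , zero , b) β d≢ with crosses b in eq
  ... | true  = ⊥-elim (d≢ refl)
  ... | false = trans (cong rowColour (p-s b)) (rowColour-p eq)
  colour-nbr′ (src , zero , b) γ d≢ = refl
  colour-nbr′ (tgt , zero , b) α d≢ = refl
  colour-nbr′ (tgt , zero , b) β d≢ with crosses (p b) in eq
  ... | true  = ⊥-elim (d≢ refl)
  ... | false = sym (rowColour-p eq)
  colour-nbr′ (tgt , zero , b) γ d≢ with crosses (p b) in eq
  ... | true  = trans (sym (colour-nbr (last b) γ (crosses-left b eq ∘ sym))) (trans (cong colour (nbr-last b)) (sym (rowColour-crossing eq)))
  ... | false = ⊥-elim (d≢ refl)
  colour-nbr′ (src , suc zero , b) α d≢ with crosses b in eq
  ... | true  = ⊥-elim (d≢ refl)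
  ... | false = sym (rowColour-p eq)
  colour-nbr′ (src , suc zero , b) β d≢ = cong rowColour (p-s b)
  colour-nbr′ (src , suc zero , b) γ d≢ with crosses b in eq
  ... | true  = sym (rowColour-crossing eq)
  ... | false = ⊥-elim (d≢ refl)
  colour-nbr′ (tgt , suc zero , b) α d≢ with crosses b in eq
  ... | true  = ⊥-elim (d≢ refl)
  ... | false = rowColour-p eq
  colour-nbr′ (tgt , suc zero , b) β d≢ = refl
  colour-nbr′ (tgt , suc zero , b) γ d≢ = refl

  Linked′ : H.V → H.V → Set
  Linked′ = H.Linked omit′

  edge : ∀ v d {w} → d ≢ omit′ v → H.nbr d v ≡ w → Linked′ v w
  edge v d d≢ refl = H.use d d≢ ◅ ε

  if-≢ : ∀ {d e f : Dir} x → f ≢ d → f ≢ e → f ≢ (if x then d else e)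
  if-≢ true  f≢d f≢e = f≢d
  if-≢ false f≢d f≢e = f≢e

  if-≢-true : ∀ {d e f : Dir} {x} → x ≡ true → f ≢ d → f ≢ (if x then d else e)
  if-≢-true refl f≢d = f≢d

  if-≢-false : ∀ {d e f : Dir} {x} → x ≡ false → f ≢ e → f ≢ (if x then d else e)
  if-≢-false refl f≢e = f≢e

  -- The detour: up the new column 0 until the next crossing row and back down the new column 1.
  detour : ∀ b → Linked′ (tgt , zero , s b) (src , suc zero , b)
  detour = cyclic-coinduction _ {p (proj₁ crossed)}
             (turn _ (trans (cong crosses (s-p _)) (≢γ⇒crosses (proj₂ crossed))))
             λ b ih → step b ih (crosses (s b)) refl
    where
    up : ∀ b → Linked′ (tgt , zero , b) (src , zero , b)
    up b = edge _ α (if-≢ (crosses (p b)) (λ ()) (λ ())) refl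
    down : ∀ b → Linked′ (tgt , suc zero , s b) (src , suc zero , b)
    down b = edge _ β (if-≢ (crosses (s b)) (λ ()) (λ ())) (cong (λ x → src , suc zero , x) (p-s b))
    turn : ∀ b → crosses (s b) ≡ true → Linked′ (tgt , zero , s b) (src , suc zero , b)
    turn b t = up (s b) ◅◅ edge (src , zero , s b) γ (if-≢-true t (λ ())) refl ◅◅ down b
    step : ∀ b → Linked′ (tgt , zero , s (s b)) (src , suc zero , s b) → ∀ x → crosses (s b) ≡ x →
           Linked′ (tgt , zero , s b) (src , suc zero , b)
    step b ih true  eq = turn b eq
    step b ih false eq = up (s b) ◅◅ edge (src , zero , s b) β (if-≢-false eq (λ ())) refl ◅◅ ih ◅◅
                         edge (src , suc zero , s b) α (if-≢-false eq (λ ())) refl ◅◅ down b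

  open H.Matching omit′ omit-nbr′ using () renaming (linked-sym to linked-sym′)

  crossing : ∀ b → crosses (p b) ≡ true → Linked′ (ι (last b)) (ι (tgt , zero , p b))
  crossing b t = edge (ι (last b)) γ (crosses-left b t ∘ sym) (nbr-last′ b)
    ◅◅ subst (λ x → Linked′ (tgt , zero , x) (src , suc zero , p b)) (s-p b) (detour (p b))
    ◅◅ edge (src , suc zero , p b) γ (if-≢-true t (λ ())) refl

  old-used : ∀ {v w} → G.Used omit v w → Linked′ (ι v) (ι w)
  old-used (G.use {v@(src , _)} α d≢) = edge (ι v) α d≢ refl
  old-used (G.use {v@(src , _)} β d≢) = edge (ι v) β d≢ refl
  old-used (G.use {v@(tgt , _)} α d≢) = edge (ι v) α d≢ refl
  old-used (G.use {v@(tgt , _)} β d≢) = edge (ι v) β d≢ refl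
  old-used (G.use {v} γ d≢) with position v
  ... | away inner = edge (ι v) γ d≢ inner
  ... | left b     = subst (Linked′ (ι (last b))) (cong ι (sym (nbr-last b))) (crossing b (crosses-left⁻ b (d≢ ∘ sym)))
  ... | right b    = linked-sym′ (subst (λ x → Linked′ (ι (last (s b))) (tgt , suc (suc zero) , x)) (p-s b)
                       (crossing (s b) (trans (cong crosses (p-s b)) (≢γ⇒crosses (d≢ ∘ sym)))))

  old-linked : ∀ {v w} → G.Linked omit v w → Linked′ (ι v) (ι w)
  old-linked = kleisliStar ι old-used

  to-old-src₁ : ∀ b → ∃ λ w → Linked′ (src , suc zero , b) (ι w)
  to-old-src₁ = cyclic-induction _ {proj₁ crossed} (_ , out _ (≢γ⇒crosses (proj₂ crossed)))
                  λ b ih → step b ih (crosses (s b)) refl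
    where
    out : ∀ b → crosses b ≡ true → Linked′ (src , suc zero , b) (ι (tgt , zero , b))
    out b t = edge _ γ (if-≢-true t (λ ())) refl
    step : ∀ b → (∃ λ w → Linked′ (src , suc zero , b) (ι w)) → ∀ x → crosses (s b) ≡ x →
           ∃ λ w → Linked′ (src , suc zero , s b) (ι w)
    step b ih true  eq = _ , out (s b) eq
    step b (w , l) false eq = w , edge _ α (if-≢-false eq (λ ())) refl
      ◅◅ edge (tgt , suc zero , s b) β (if-≢ (crosses (s b)) (λ ()) (λ ())) (cong (λ x → src , suc zero , x) (p-s b)) ◅◅ l

  to-old : ∀ v → ∃ λ w → Linked′ v (ι w)
  to-old (x , suc (suc c) , b) = (x , c , b) , ε
  to-old (src , suc zero , b)  = to-old-src₁ b
  to-old (tgt , suc zero , b)  = let w , l = to-old-src₁ (p b) in w , edge _ β (if-≢ (crosses b) (λ ()) (λ ())) refl ◅◅ l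
  to-old (tgt , zero , b)      = let w , l = to-old-src₁ (p b) in
    w , subst (λ x → Linked′ (tgt , zero , x) (src , suc zero , p b)) (s-p b) (detour (p b)) ◅◅ l
  to-old (src , zero , b)      = let w , l = to-old (tgt , zero , b) in
    w , edge _ α (if-≢ (crosses b) (λ ()) (λ ())) refl ◅◅ l

  inserted : TwoCycles (Torus (suc (suc m)) τ)
  inserted = record
    { omit = omit′ ; omit-nbr = omit-nbr′ ; colour = colour′ ; colour-nbr = colour-nbr′ ; linked = linked′ }
    where
    same : ∀ {v w} → Linked′ v w → colour′ v ≡ colour′ w
    same = H.colour-invariant omit′ colour′ colour-nbr′
    linked′ : ∀ v w → colour′ v ≡ colour′ w → Linked′ v w
    linked′ v w eq =
      let v₀ , lv = to-old v
          w₀ , lw = to-old w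
      in lv ◅◅ old-linked (linked v₀ w₀ (trans (sym (same lv)) (trans eq (same lw)))) ◅◅ linked-sym′ lw

-- Translations act transitively on each side. Columns are moved while the row is left arbitrary,
-- since passing the last column changes the row by `K`; rows are moved within column `c₀` alone.
-- Separability is pulled back from the translated pair, hence the coinduction.
allSeparable-from : ∀ m {n} (τ : Twist n) c₀ a₀ →
  (∀ x v → (x , c₀ , a₀) ≢ v → Separable (Torus m τ) (x , c₀ , a₀) v) → AllSeparable (Torus m τ)
allSeparable-from m {n} τ c₀ a₀ sep (x , c , a) v = from-column c (x , c , a) v refl
  where
  module R = Iso (torus-translation m τ β)
  module C = Iso (torus-translation m τ γ)
  from-row : ∀ a x v → (x , c₀ , a) ≢ v → Separable (Torus m τ) (x , c₀ , a) v
  from-row = cyclic-coinduction _ {a₀} sep λ a ih x v u≢v → R.separable (ih x (R.f v) (u≢v ∘ R.f-injective))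
  column-hop : ∀ u → column m τ (C.f u) ≡ s (column m τ u)
  column-hop (x , c , a) with view c
  ... | ‵fromℕ     = refl
  ... | ‵inject₁ j = refl
  from-column : ∀ c u v → column m τ u ≡ c → u ≢ v → Separable (Torus m τ) u v
  from-column = cyclic-coinduction _ {c₀} (λ { (x , _ , a) v refl → from-row a x v }) λ c ih u v eq u≢v →
    C.separable (ih (C.f u) (C.f v) (trans (column-hop u) (cong s eq)) (u≢v ∘ C.f-injective))

-- Translating by columns moves u and v off the two inserted columns.
allSeparable-insertion : ∀ m {n} (τ : Twist n) →
  AllSeparable (Torus (suc (suc m)) (p-twist τ)) → AllSeparable (Torus (suc (suc (suc (suc m)))) τ)
allSeparable-insertion m {n} τ all = allSeparable-from _ τ (suc (suc zero)) zero separable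
  where
  G : Graph
  G = Torus (suc (suc (suc (suc m)))) τ
  module T = Iso (torus-translation (suc (suc (suc (suc m)))) τ γ)
  separable-old : ∀ x c a y d b → (x , c , a) ≢ (y , d , b) → Separable G (x , suc (suc c) , a) (y , suc (suc d) , b)
  separable-old x c a y d b u≢v with F , ≢ ← all (x , c , a) (y , d , b) u≢v =
    Insertion.inserted _ τ F (cut-is-crossed F) , ≢
  separable : ∀ x v → (x , suc (suc zero) , zero) ≢ v → Separable G (x , suc (suc zero) , zero) v
  separable x (y , zero , b) u≢v =
    T.separable (T.separable (separable-old x (suc (suc zero)) zero y zero b λ ()))
  separable x (y , suc zero , b) u≢v =
    T.separable (T.separable (separable-old x (suc (suc zero)) zero y (suc zero) b λ ()))
  separable x (y , suc (suc d) , b) u≢v = separable-old x zero zero y d b λ { refl → u≢v refl }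

-- Certificates

_≟ˢ_ : DecidableEquality Side
src ≟ˢ src = yes refl
src ≟ˢ tgt = no λ ()
tgt ≟ˢ src = no λ ()
tgt ≟ˢ tgt = yes refl

allSides? : {P : Side → Set} → (∀ x → Dec (P x)) → Dec (∀ x → P x)
allSides? P? = map′ (λ { (a , b) src → a ; (a , b) tgt → b }) (λ f → f src , f tgt) (P? src ×-dec P? tgt)

allDirs? : {P : Dir → Set} → (∀ d → Dec (P d)) → Dec (∀ d → P d)
allDirs? P? = map′ (λ { (a , b , c) α → a ; (a , b , c) β → b ; (a , b , c) γ → c }) (λ f → f α , f β , f γ)
                (P? α ×-dec P? β ×-dec P? γ)

Table : ℕ → ℕ → Set
Table m n = Vec (Vec Dir (suc n)) (suc m)

-- The directions omitted at the sources, column by column, together with the row of a source of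
-- column 0 on the cycle avoiding the source (0 , 0).
Certificate : ℕ → ℕ → Set
Certificate m n = Table m n × Fin (suc n)

module Checker (m : ℕ) {n : ℕ} (τ : Twist n) where
  open Graph (Torus m τ)

  infix 4 _≟ᵛ_
  _≟ᵛ_ : DecidableEquality V
  _≟ᵛ_ = ≡-dec _≟ˢ_ (≡-dec Fin._≟_ Fin._≟_)

  allVertices? : {P : V → Set} → (∀ v → Dec (P v)) → Dec (∀ v → P v)
  allVertices? P? = map′ (λ f (x , c , a) → f x c a) (λ f x c a → f (x , c , a))
    (allSides? λ x → Fin.all? λ c → Fin.all? λ a → P? (x , c , a))

  fuel : ℕ
  fuel = 2 * (suc m * suc n)

  module _ (table : Table m n) where
    omit : V → Dir
    omit (src , c , a) = lookup (lookup table c) a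
    omit (tgt , x) with omit (src , from α x) ≟ᵈ α | omit (src , from β x) ≟ᵈ β
    ... | yes _ | _     = α
    ... | no _  | yes _ = β
    -- Only a default: `Consistent` checks whether the target really is matched by `γ`.
    ... | no _  | no _  = γ

    -- The argument `d` is the direction of arrival, so the walk leaves by the other used one. An
    -- answer `true` yields a path; an answer `false` proves nothing by itself.
    reaches : V → ℕ → Dir → V → Bool
    reaches root k d v with v ≟ᵛ root
    ... | yes _ = true
    reaches root zero    d v | no _ = false
    reaches root (suc k) d v | no _ = reaches root k (third (omit v) d) (nbr (third (omit v) d) v)

    reaches-sound : ∀ root k d v → reaches root k d v ≡ true → Linked omit v root
    reaches-sound root k d v eq with v ≟ᵛ root
    ... | yes refl = ε
    reaches-sound root (suc k) d v eq | no _ =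
      use (third (omit v) d) (third-≢ˡ (omit v) d) ◅ reaches-sound root k _ _ eq

    onCycleOf : V → V → Bool
    onCycleOf root v = reaches root fuel (third (omit v) (omit v)) v

    onCycleOf-sound : ∀ {root v} → onCycleOf root v ≡ true → Linked omit v root
    onCycleOf-sound = reaches-sound _ fuel _ _

    Consistent : Set
    Consistent = ∀ v → omit (nbr (omit v) v) ≡ omit v

    consistent? : Dec Consistent
    consistent? = allVertices? λ v → omit (nbr (omit v) v) ≟ᵈ omit v

    -- This is what gives meaning to the answer `false`: if reachability of `root` is constant along
    -- used edges, then no path leads from a `false` vertex to `root`.
    Invariant : V → Set
    Invariant root = ∀ v d → d ≡ omit v ⊎ onCycleOf root (nbr d v) ≡ onCycleOf root v

    invariant? : ∀ root → Dec (Invariant root)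
    invariant? root = allVertices? λ v → allDirs? λ d →
      (d ≟ᵈ omit v) ⊎-dec (onCycleOf root (nbr d v) Bool.≟ onCycleOf root v)

    invariant-nbr : ∀ {root} → Invariant root → ∀ v d → d ≢ omit v → onCycleOf root (nbr d v) ≡ onCycleOf root v
    invariant-nbr inv v d d≢ with inv v d
    ... | inj₁ eq = ⊥-elim (d≢ eq)
    ... | inj₂ eq = eq

  root : V
  root = src , zero , zero

  module _ (cert : Certificate m n) where
    private
      table = proj₁ cert
      root′ : V
      root′ = src , zero , proj₂ cert

    colour : V → Bool
    colour = onCycleOf table root

    Valid : Set
    Valid = Consistent table × Invariant table root × (∀ v → colour v ≡ true ⊎ onCycleOf table root′ v ≡ true)

    valid? : Dec Valid
    valid? = consistent? table ×-dec invariant? table root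
      ×-dec allVertices? λ v → (colour v Bool.≟ true) ⊎-dec (onCycleOf table root′ v Bool.≟ true)

    twoCycles : Valid → TwoCycles (Torus m τ)
    twoCycles (consistent , invariant , covered) = record
      { omit = omit table ; omit-nbr = consistent ; colour = colour
      ; colour-nbr = invariant-nbr table {root} invariant ; linked = linked }
      where
      open Matching (omit table) consistent
      to-root′ : ∀ v → colour v ≡ false → Linked (omit table) v root′
      to-root′ v eq with covered v
      ... | inj₁ t with () ← trans (sym t) eq
      ... | inj₂ t = onCycleOf-sound table t
      linked : ∀ v w → colour v ≡ colour w → Linked (omit table) v w
      linked v w eq with colour w in eqw
      ... | true  = onCycleOf-sound table eq ◅◅ linked-sym (onCycleOf-sound table eqw)
      ... | false = to-root′ v eq ◅◅ linked-sym (to-root′ w eqw)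

  -- By translation it is enough to separate the two vertices in row 0 of column 0 from all others.
  -- Separating the ends of an edge requires omitting it, so at least three factors are needed, one
  -- for each direction at the source; each list below has exactly three, whose tables begin with
  -- `α`, `β` and `γ`.
  Separating : List (Certificate m n) → Set
  Separating certs = All Valid certs ×
    (∀ x v → (x , zero , zero) ≡ v ⊎ Any (λ cert → colour cert (x , zero , zero) ≢ colour cert v) certs)

  separating? : ∀ certs → Dec (Separating certs)
  separating? certs = all? valid? certs ×-dec
    allSides? λ x → allVertices? λ v → ((x , zero , zero) ≟ᵛ v) ⊎-dec
      any? (λ cert → ¬? (colour cert (x , zero , zero) Bool.≟ colour cert v)) certs

  separating⇒allSeparable : ∀ certs → Separating certs → AllSeparable (Torus m τ)
  separating⇒allSeparable certs (valid , sep) = allSeparable-from m τ zero zero λ x v u≢v → pick u≢v (sep x v)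
    where
    find : ∀ {u v certs} → All Valid certs → Any (λ cert → colour cert u ≢ colour cert v) certs → Separable (Torus m τ) u v
    find (ok ∷ _) (here ≢)  = twoCycles _ ok , ≢
    find (_ ∷ ok) (there i) = find ok i
    pick : ∀ {x v} → (x , zero , zero) ≢ v → _ → Separable (Torus m τ) (x , zero , zero) v
    pick u≢v (inj₁ eq) = ⊥-elim (u≢v eq)
    pick u≢v (inj₂ i)  = find valid i

-- certificates-c-r-k is for the torus with c columns, r rows and K = sᵏ; found by computer search.

certificates-4-3-0 : List (Certificate 3 2)
certificates-4-3-0 =
    ((α ∷ α ∷ γ ∷ []) ∷ (α ∷ α ∷ γ ∷ []) ∷ (α ∷ α ∷ γ ∷ []) ∷ (α ∷ α ∷ γ ∷ []) ∷ [] , suc zero) ∷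
    ((β ∷ β ∷ γ ∷ []) ∷ (α ∷ α ∷ γ ∷ []) ∷ (β ∷ γ ∷ β ∷ []) ∷ (γ ∷ β ∷ β ∷ []) ∷ [] , suc zero) ∷
    ((γ ∷ α ∷ β ∷ []) ∷ (β ∷ β ∷ γ ∷ []) ∷ (β ∷ γ ∷ β ∷ []) ∷ (α ∷ β ∷ γ ∷ []) ∷ [] , suc zero) ∷
    []

separating-4-3-0 : Checker.Separating 3 (s-power 0) certificates-4-3-0
separating-4-3-0 = from-yes (Checker.separating? 3 (s-power 0) certificates-4-3-0)

certificates-4-3-1 : List (Certificate 3 2)
certificates-4-3-1 =
    ((α ∷ α ∷ γ ∷ []) ∷ (α ∷ α ∷ γ ∷ []) ∷ (α ∷ α ∷ γ ∷ []) ∷ (β ∷ γ ∷ β ∷ []) ∷ [] , suc zero) ∷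
    ((β ∷ β ∷ γ ∷ []) ∷ (β ∷ γ ∷ β ∷ []) ∷ (γ ∷ β ∷ β ∷ []) ∷ (β ∷ β ∷ γ ∷ []) ∷ [] , suc zero) ∷
    ((γ ∷ α ∷ β ∷ []) ∷ (γ ∷ α ∷ α ∷ []) ∷ (γ ∷ α ∷ α ∷ []) ∷ (β ∷ γ ∷ α ∷ []) ∷ [] , suc zero) ∷
    []

separating-4-3-1 : Checker.Separating 3 (s-power 1) certificates-4-3-1
separating-4-3-1 = from-yes (Checker.separating? 3 (s-power 1) certificates-4-3-1)

certificates-4-3-2 : List (Certificate 3 2)
certificates-4-3-2 =
    ((α ∷ α ∷ γ ∷ []) ∷ (α ∷ α ∷ γ ∷ []) ∷ (β ∷ γ ∷ β ∷ []) ∷ (γ ∷ β ∷ β ∷ []) ∷ [] , suc zero) ∷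
    ((β ∷ β ∷ γ ∷ []) ∷ (α ∷ α ∷ γ ∷ []) ∷ (α ∷ α ∷ γ ∷ []) ∷ (β ∷ γ ∷ β ∷ []) ∷ [] , suc zero) ∷
    ((γ ∷ α ∷ β ∷ []) ∷ (β ∷ β ∷ γ ∷ []) ∷ (α ∷ α ∷ γ ∷ []) ∷ (γ ∷ α ∷ β ∷ []) ∷ [] , suc zero) ∷
    []

separating-4-3-2 : Checker.Separating 3 (s-power 2) certificates-4-3-2
separating-4-3-2 = from-yes (Checker.separating? 3 (s-power 2) certificates-4-3-2)

certificates-5-3-0 : List (Certificate 4 2)
certificates-5-3-0 =
    ((α ∷ β ∷ γ ∷ []) ∷ (α ∷ α ∷ γ ∷ []) ∷ (β ∷ γ ∷ β ∷ []) ∷ (α ∷ β ∷ γ ∷ []) ∷ (β ∷ γ ∷ β ∷ []) ∷ [] , suc (suc zero)) ∷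
    ((β ∷ γ ∷ α ∷ []) ∷ (α ∷ β ∷ γ ∷ []) ∷ (α ∷ α ∷ γ ∷ []) ∷ (β ∷ γ ∷ β ∷ []) ∷ (γ ∷ β ∷ β ∷ []) ∷ [] , suc zero) ∷
    ((γ ∷ α ∷ β ∷ []) ∷ (β ∷ β ∷ γ ∷ []) ∷ (α ∷ α ∷ γ ∷ []) ∷ (β ∷ γ ∷ β ∷ []) ∷ (α ∷ β ∷ γ ∷ []) ∷ [] , suc zero) ∷
    []

separating-5-3-0 : Checker.Separating 4 (s-power 0) certificates-5-3-0
separating-5-3-0 = from-yes (Checker.separating? 4 (s-power 0) certificates-5-3-0)

certificates-5-3-1 : List (Certificate 4 2)
certificates-5-3-1 =
    ((α ∷ β ∷ γ ∷ []) ∷ (α ∷ α ∷ γ ∷ []) ∷ (α ∷ α ∷ γ ∷ []) ∷ (α ∷ α ∷ γ ∷ []) ∷ (γ ∷ α ∷ β ∷ []) ∷ [] , suc (suc zero)) ∷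
    ((β ∷ γ ∷ α ∷ []) ∷ (α ∷ β ∷ γ ∷ []) ∷ (α ∷ α ∷ γ ∷ []) ∷ (α ∷ α ∷ γ ∷ []) ∷ (α ∷ α ∷ γ ∷ []) ∷ [] , suc zero) ∷
    ((γ ∷ α ∷ β ∷ []) ∷ (β ∷ β ∷ γ ∷ []) ∷ (β ∷ γ ∷ β ∷ []) ∷ (α ∷ β ∷ γ ∷ []) ∷ (β ∷ γ ∷ β ∷ []) ∷ [] , suc zero) ∷
    []

separating-5-3-1 : Checker.Separating 4 (s-power 1) certificates-5-3-1
separating-5-3-1 = from-yes (Checker.separating? 4 (s-power 1) certificates-5-3-1)

certificates-5-3-2 : List (Certificate 4 2)
certificates-5-3-2 =
    ((α ∷ β ∷ γ ∷ []) ∷ (α ∷ α ∷ γ ∷ []) ∷ (α ∷ α ∷ γ ∷ []) ∷ (β ∷ γ ∷ β ∷ []) ∷ (α ∷ β ∷ γ ∷ []) ∷ [] , suc (suc zero)) ∷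
    ((β ∷ γ ∷ α ∷ []) ∷ (α ∷ β ∷ γ ∷ []) ∷ (α ∷ α ∷ γ ∷ []) ∷ (α ∷ α ∷ γ ∷ []) ∷ (β ∷ γ ∷ β ∷ []) ∷ [] , suc zero) ∷
    ((γ ∷ α ∷ β ∷ []) ∷ (β ∷ β ∷ γ ∷ []) ∷ (α ∷ α ∷ γ ∷ []) ∷ (α ∷ α ∷ γ ∷ []) ∷ (γ ∷ α ∷ β ∷ []) ∷ [] , suc zero) ∷
    []

separating-5-3-2 : Checker.Separating 4 (s-power 2) certificates-5-3-2
separating-5-3-2 = from-yes (Checker.separating? 4 (s-power 2) certificates-5-3-2)

certificates-1-4-2 : List (Certificate 0 3)
certificates-1-4-2 =
    ((α ∷ γ ∷ α ∷ γ ∷ []) ∷ [] , suc (suc zero)) ∷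
    ((β ∷ β ∷ β ∷ β ∷ []) ∷ [] , suc zero) ∷
    ((γ ∷ α ∷ γ ∷ α ∷ []) ∷ [] , suc zero) ∷
    []

separating-1-4-2 : Checker.Separating 0 (s-power 2) certificates-1-4-2
separating-1-4-2 = from-yes (Checker.separating? 0 (s-power 2) certificates-1-4-2)

-- Tori with three rows, and tori with an odd number of columns

twist-3 : ∀ (τ : Twist 2) k → Twist.K τ zero ≡ Twist.K (s-power k) zero → ∀ a → Twist.K τ a ≡ Twist.K (s-power k) a
twist-3 τ k eq = cyclic-induction _ eq λ a ih →
  trans (Twist.K-s τ a) (trans (cong s ih) (sym (Twist.K-s (s-power k) a)))

-- A twist of three rows is determined by its value at row 0, so each of the two starting numbers of
-- columns needs three certified tori.
allSeparable-3-rows : ∀ m (τ : Twist 2) → AllSeparable (Torus (3 + m) τ)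
allSeparable-3-rows zero τ with Twist.K τ zero in eq
... | zero          = Iso.allSeparable (torus-cong 3 τ (s-power 0) (twist-3 τ 0 eq)) (Checker.separating⇒allSeparable 3 (s-power 0) _ separating-4-3-0)
... | suc zero      = Iso.allSeparable (torus-cong 3 τ (s-power 1) (twist-3 τ 1 eq)) (Checker.separating⇒allSeparable 3 (s-power 1) _ separating-4-3-1)
... | suc (suc zero) = Iso.allSeparable (torus-cong 3 τ (s-power 2) (twist-3 τ 2 eq)) (Checker.separating⇒allSeparable 3 (s-power 2) _ separating-4-3-2)
allSeparable-3-rows (suc zero) τ with Twist.K τ zero in eq
... | zero          = Iso.allSeparable (torus-cong 4 τ (s-power 0) (twist-3 τ 0 eq)) (Checker.separating⇒allSeparable 4 (s-power 0) _ separating-5-3-0)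
... | suc zero      = Iso.allSeparable (torus-cong 4 τ (s-power 1) (twist-3 τ 1 eq)) (Checker.separating⇒allSeparable 4 (s-power 1) _ separating-5-3-1)
... | suc (suc zero) = Iso.allSeparable (torus-cong 4 τ (s-power 2) (twist-3 τ 2 eq)) (Checker.separating⇒allSeparable 4 (s-power 2) _ separating-5-3-2)
allSeparable-3-rows (suc (suc m)) τ = allSeparable-insertion (suc m) τ (allSeparable-3-rows m (p-twist τ))

-- The translation (1 , -1) has order 3 in the torus with 3 columns and K = s³, so the zigzags in its
-- direction serve as the columns of a torus with 3 rows.
quarter-turn : ∀ n → Iso (Torus 2 {n} (s-power 3)) (Torus n {2} id-twist)
quarter-turn n = record
  { f = f ; g = g ; g-f = g-f ; f-g = f-g ; π = π ; π⁻ = π⁻ ; π⁻-π = π⁻-π ; π-π⁻ = π-π⁻ ; f-nbr = f-nbr }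
  where
  module G = Graph (Torus 2 {n} (s-power 3))
  module H = Graph (Torus n {2} id-twist)
  η : G.A → H.A
  -- A point (c , b) goes to column c + b, which is constant in the direction (1 , -1), and to row
  -- -c modulo 3.
  η (zero , b)           = b , zero
  η (suc zero , b)       = s b , suc (suc zero)
  η (suc (suc zero) , b) = s (s b) , suc zero
  θ : H.A → G.A
  θ (c , zero)           = zero , c
  θ (c , suc zero)       = suc (suc zero) , p (p c)
  θ (c , suc (suc zero)) = suc zero , p c
  θ-η : ∀ x → θ (η x) ≡ x
  θ-η (zero , b)           = refl
  θ-η (suc zero , b)       = cong (suc zero ,_) (p-s b)
  θ-η (suc (suc zero) , b) = cong (suc (suc zero) ,_) (trans (cong p (p-s (s b))) (p-s b))
  η-θ : ∀ x → η (θ x) ≡ x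
  η-θ (c , zero)           = refl
  η-θ (c , suc zero)       = cong (_, suc zero) (trans (cong s (s-p (p c))) (s-p c))
  η-θ (c , suc (suc zero)) = cong (_, suc (suc zero)) (s-p c)
  f : G.V → H.V
  -- The ends of a `β` edge receive the same coordinates, because `β` edges are to become the `α`
  -- edges of the new torus.
  f (src , x) = tgt , η (G.to β x)
  f (tgt , x) = src , η x
  g : H.V → G.V
  g (src , y) = tgt , θ y
  g (tgt , y) = src , G.from β (θ y)
  g-f : ∀ v → g (f v) ≡ v
  g-f (src , x) = cong (src ,_) (trans (cong (G.from β) (θ-η _)) (G.from-to β x))
  g-f (tgt , x) = cong (tgt ,_) (θ-η x)
  f-g : ∀ w → f (g w) ≡ w
  f-g (src , y) = cong (src ,_) (η-θ y)
  f-g (tgt , y) = cong (tgt ,_) (trans (cong η (G.to-from β _)) (η-θ y))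
  π π⁻ : Dir → Dir
  π α = γ
  π β = α
  π γ = β
  π⁻ α = β
  π⁻ β = γ
  π⁻ γ = α
  π⁻-π : ∀ d → π⁻ (π d) ≡ d
  π⁻-π α = refl
  π⁻-π β = refl
  π⁻-π γ = refl
  π-π⁻ : ∀ d → π (π⁻ d) ≡ d
  π-π⁻ α = refl
  π-π⁻ β = refl
  π-π⁻ γ = refl
  hop-id : ∀ x → H.to γ x ≡ (s (proj₁ x) , proj₂ x)
  hop-id (c , a) with view c
  ... | ‵fromℕ     = refl
  ... | ‵inject₁ j = refl
  η-s : ∀ x → η (G.to β x) ≡ (s (proj₁ (η x)) , proj₂ (η x))
  η-s (zero , b)           = refl
  η-s (suc zero , b)       = refl
  η-s (suc (suc zero) , b) = refl
  f-nbr-tgt : ∀ d x → f (G.nbr d (tgt , x)) ≡ H.nbr (π d) (f (tgt , x))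
  f-nbr-tgt α x = cong (tgt ,_) (trans (η-s x) (sym (hop-id (η x))))
  f-nbr-tgt β x = cong (λ y → tgt , η y) (G.to-from β x)
  f-nbr-tgt γ (zero , b) = cong (λ y → tgt , y , suc zero)
    (trans (cong (s ∘ s) (s-p _)) (trans (cong s (s-p _)) (s-p _)))
  f-nbr-tgt γ (suc zero , b) = refl
  f-nbr-tgt γ (suc (suc zero) , b) = refl
  f-nbr : ∀ d v → f (G.nbr d v) ≡ H.nbr (π d) (f v)
  f-nbr d (tgt , x)   = f-nbr-tgt d x
  f-nbr d v@(src , x) = begin
    f (G.nbr d v)                           ≡⟨ H.nbr-invol (π d) _ ⟨
    H.nbr (π d) (H.nbr (π d) (f (G.nbr d v))) ≡⟨ cong (H.nbr (π d)) (f-nbr-tgt d (G.to d x)) ⟨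
    H.nbr (π d) (f (G.nbr d (G.nbr d v)))   ≡⟨ cong (H.nbr (π d) ∘ f) (G.nbr-invol d v) ⟩
    H.nbr (π d) (f v)                       ∎

-- These are the tori of HTG(2k + 3, 2n + 8, 3). The family is closed under insertion, since two
-- more columns raise the exponent of the twist by one.
allSeparable-odd-columns : ∀ k n → AllSeparable (Torus (2 + k * 2) {3 + n} (s-power (3 + k)))
allSeparable-odd-columns zero n = Iso.allSeparable (quarter-turn (3 + n)) (allSeparable-3-rows n id-twist)
allSeparable-odd-columns (suc k) n = allSeparable-insertion (k * 2) (s-power (4 + k))
  (Iso.allSeparable (torus-cong _ (p-twist (s-power (4 + k))) (s-power (3 + k)) λ a → p-s _) (allSeparable-odd-columns k n))

-- Tori with one column

even : ℕ → Bool
even zero    = true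
even (suc k) = not (even k)

-- Without the `β` edges, source a is joined through target a to source a - 2. As the number n + 1
-- of rows is even, the two parities give two cycles.
module Alternating {n : ℕ} (n-odd : even n ≡ false) where
  open Graph (Torus 0 {n} (s-power 2))

  even-s : ∀ a → even (toℕ (s {n} a)) ≡ not (even (toℕ a))
  even-s a with view a
  ... | ‵fromℕ     = sym (cong not (trans (cong even (Fin.toℕ-fromℕ n)) n-odd))
  ... | ‵inject₁ j = sym (cong (not ∘ even) (Fin.toℕ-inject₁ j))

  even-s-s : ∀ a → even (toℕ (s {n} (s a))) ≡ even (toℕ a)
  even-s-s a = trans (even-s (s a)) (trans (cong not (even-s a)) (Bool.not-involutive _))

  omit : V → Dir
  omit _ = β

  colour : V → Bool
  colour (_ , _ , a) = even (toℕ a)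

  open Matching omit (λ _ → refl)

  root : Bool → V
  root true  = src , zero , zero
  root false = src , zero , s zero

  two-rows : ∀ a → Linked omit (src , zero , s (s a)) (src , zero , a)
  two-rows a = use α (λ ()) ◅ subst (λ x → Linked omit (tgt , zero , s (s a)) (src , x)) (hop⁻-hop 0 (s-power 2) (zero , a)) (use γ (λ ()) ◅ ε)

  to-root : ∀ a → Linked omit (src , zero , a) (root (even (toℕ a)))
  to-root a = proj₁ (cyclic-induction (λ a → Linked omit (src , zero , a) (root (even (toℕ a)))
                                × Linked omit (src , zero , s a) (root (even (toℕ (s a)))))
    (ε , subst (Linked omit (src , zero , s zero) ∘ root) (sym (even-s zero)) ε)
    (λ a (la , lsa) → lsa , subst (Linked omit (src , zero , s (s a)) ∘ root) (sym (even-s-s a)) (two-rows a ◅◅ la)) a)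

  to-root′ : ∀ v → Linked omit v (root (colour v))
  to-root′ (src , zero , a) = to-root a
  to-root′ (tgt , zero , a) = use α (λ ()) ◅ to-root a

  alternating : TwoCycles (Torus 0 {n} (s-power 2))
  alternating = record
    { omit = omit ; omit-nbr = λ _ → refl ; colour = colour ; colour-nbr = colour-nbr
    ; linked = λ v w eq → to-root′ v ◅◅ subst (λ b → Linked omit (root b) w) (sym eq) (linked-sym (to-root′ w)) }
    where
    colour-nbr : ∀ v d → d ≢ β → colour (nbr d v) ≡ colour v
    colour-nbr (src , zero , a) α d≢ = refl
    colour-nbr (tgt , zero , a) α d≢ = refl
    colour-nbr v β d≢ = ⊥-elim (d≢ refl)
    colour-nbr (src , zero , a) γ d≢ = even-s-s a
    colour-nbr (tgt , zero , a) γ d≢ = trans (sym (even-s-s (p (p a)))) (cong (even ∘ toℕ) (trans (cong s (s-p (p a))) (s-p a)))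

pattern row0 = zero
pattern row1 = suc zero
pattern row2 = suc (suc zero)
pattern row3 = suc (suc (suc zero))
pattern row4 = suc (suc (suc (suc zero)))
pattern 3+row j = suc (suc (suc j))
pattern 4+row j = suc (suc (suc (suc j)))
pattern 5+row j = suc (suc (suc (suc (suc j))))

-- The 4-cycle runs from source 1 by `β` to target 2, by `α` to source 2, by `β` to target 3 and by
-- `γ` back. Rows 0 to 4 must be distinct for this pattern, so the torus with four rows has
-- certificates instead.
module FourCycle (n : ℕ) where
  open Graph (Torus 0 {4 + n} (s-power 2))

  omit : V → Dir
  omit (src , _ , row0) = γ
  omit (src , _ , row1) = α
  omit (src , _ , row2) = γ
  omit (src , _ , row3) = α
  omit (src , _ , 4+row _) = β
  omit (tgt , _ , row0) = β
  omit (tgt , _ , row1) = α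
  omit (tgt , _ , row2) = γ
  omit (tgt , _ , row3) = α
  omit (tgt , _ , row4) = γ
  omit (tgt , _ , 5+row _) = β

  colour : V → Bool
  colour (src , _ , row1) = true
  colour (src , _ , row2) = true
  colour (src , _ , _)    = false
  colour (tgt , _ , row2) = true
  colour (tgt , _ , row3) = true
  colour (tgt , _ , _)    = false

  omit-nbr : ∀ v → omit (nbr (omit v) v) ≡ omit v
  omit-nbr (src , zero , row0) = refl
  omit-nbr (src , zero , row1) = refl
  omit-nbr (src , zero , row2) = refl
  omit-nbr (src , zero , row3) = refl
  omit-nbr (src , zero , 4+row j) with view j
  ... | ‵fromℕ     = refl
  ... | ‵inject₁ i = refl
  omit-nbr (tgt , zero , row0) = refl
  omit-nbr (tgt , zero , row1) = refl
  omit-nbr (tgt , zero , row2) = refl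
  omit-nbr (tgt , zero , row3) = refl
  omit-nbr (tgt , zero , row4) = refl
  omit-nbr (tgt , zero , 5+row j) = refl

  open Matching omit omit-nbr

  colour-s : ∀ j → colour (tgt , zero , s (4+row j)) ≡ false
  colour-s j with view j
  ... | ‵fromℕ     = refl
  ... | ‵inject₁ i = refl

  colour-s-s : ∀ j → colour (tgt , zero , s (s (4+row j))) ≡ false
  colour-s-s j with view j
  ... | ‵fromℕ     = refl
  ... | ‵inject₁ i = colour-s (suc i)

  colour-src : ∀ x d → d ≢ omit (src , x) → colour (nbr d (src , x)) ≡ colour (src , x)
  colour-src (zero , row0) α d≢ = refl
  colour-src (zero , row0) β d≢ = refl
  colour-src (zero , row0) γ d≢ = ⊥-elim (d≢ refl)
  colour-src (zero , row1) α d≢ = ⊥-elim (d≢ refl)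
  colour-src (zero , row1) β d≢ = refl
  colour-src (zero , row1) γ d≢ = refl
  colour-src (zero , row2) α d≢ = refl
  colour-src (zero , row2) β d≢ = refl
  colour-src (zero , row2) γ d≢ = ⊥-elim (d≢ refl)
  colour-src (zero , row3) α d≢ = ⊥-elim (d≢ refl)
  colour-src (zero , row3) β d≢ = refl
  colour-src (zero , row3) γ d≢ = colour-s zero
  colour-src (zero , 4+row j) α d≢ = refl
  colour-src (zero , 4+row j) β d≢ = ⊥-elim (d≢ refl)
  colour-src (zero , 4+row j) γ d≢ = colour-s-s j

  colour-nbr : ∀ v d → d ≢ omit v → colour (nbr d v) ≡ colour v
  colour-nbr (src , x) d d≢ = colour-src x d d≢
  colour-nbr (tgt , x) d d≢ = sym (trans (cong colour (sym (nbr-invol d (tgt , x)))) (colour-src (from d x) d (omit-back d≢)))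

  -- Away from the 4-cycle the path descends two rows at a time, by `α` and then `γ`, so the
  -- induction carries two consecutive rows. The parities meet at the `β` edge between target 4 and
  -- source 3.
  to-row3 : ∀ j → Linked omit (src , zero , 3+row j) (src , zero , row3)
  to-row3 zero = ε
  to-row3 (suc j) = proj₂ (<-weakInduction
    (λ j → Linked omit (src , zero , 3+row (inject₁ j)) (src , zero , row3) × Linked omit (src , zero , 4+row j) (src , zero , row3))
    (ε , use α (λ ()) ◅ use β (λ ()) ◅ ε)
    (λ j (l , l′) → l′ , use α (λ ()) ◅ use γ (λ ()) ◅ l) j)

  root : Bool → V
  root true  = src , zero , row1
  root false = src , zero , row3

  to-root : ∀ v → Linked omit v (root (colour v))
  to-root (src , zero , row1) = ε
  to-root (src , zero , row2) = use α (λ ()) ◅ use β (λ ()) ◅ ε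
  to-root (tgt , zero , row2) = use β (λ ()) ◅ ε
  to-root (tgt , zero , row3) = use γ (λ ()) ◅ ε
  to-root (src , zero , row0) = use α (λ ()) ◅ use γ (λ ()) ◅ to-row3 _
  to-root (src , zero , 3+row j) = to-row3 j
  to-root (tgt , zero , row0) = use γ (λ ()) ◅ to-row3 _
  to-root (tgt , zero , row1) = use γ (λ ()) ◅ to-row3 _
  to-root (tgt , zero , row4) = use α (λ ()) ◅ to-row3 _
  to-root (tgt , zero , 5+row j) = use α (λ ()) ◅ to-row3 _

  four-cycle : TwoCycles (Torus 0 {4 + n} (s-power 2))
  four-cycle = record
    { omit = omit ; omit-nbr = omit-nbr ; colour = colour ; colour-nbr = colour-nbr
    ; linked = λ v w eq → to-root v ◅◅ subst (λ b → Linked omit (root b) w) (sym eq) (linked-sym (to-root w)) }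

-- The 4-cycle consists of the cells 1 and 2, where cell a is made of the source a and the target a + 1.
-- It separates any two cells after a translation, and the alternating factor splits each cell.
allSeparable-one-column : ∀ n → even (3 + n) ≡ false → AllSeparable (Torus 0 {3 + n} (s-power 2))
allSeparable-one-column zero _ = Checker.separating⇒allSeparable 0 (s-power 2) _ separating-1-4-2
allSeparable-one-column (suc n) n-odd = allSeparable-from 0 (s-power 2) zero row2 λ x v u≢v → sep x v u≢v (FC.colour v) refl
  where
  G : Graph
  G = Torus 0 {4 + n} (s-power 2)
  module FC = FourCycle n
  module R = Iso (torus-translation 0 (s-power {4 + n} 2) β)
  alt : TwoCycles G
  alt = Alternating.alternating n-odd
  by-4-cycle : ∀ {u v} → FC.colour u ≢ FC.colour v → Separable G u v
  by-4-cycle ≢ = FC.four-cycle , ≢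
  sep : ∀ x v → (x , zero , row2) ≢ v → ∀ b → FC.colour v ≡ b → Separable G (x , zero , row2) v
  sep src v u≢v false eq = by-4-cycle λ eq′ → case-⊥ (trans eq′ eq)
    where case-⊥ : true ≢ false
          case-⊥ ()
  sep tgt v u≢v false eq = by-4-cycle λ eq′ → case-⊥ (trans eq′ eq)
    where case-⊥ : true ≢ false
          case-⊥ ()
  sep src (src , zero , row1) u≢v true eq = R.separable (by-4-cycle λ ())
  sep src (src , zero , row2) u≢v true eq = ⊥-elim (u≢v refl)
  sep src (tgt , zero , row2) u≢v true eq = R.separable (by-4-cycle λ ())
  sep src (tgt , zero , row3) u≢v true eq = alt , λ ()
  sep tgt (src , zero , row1) u≢v true eq = alt , λ ()
  sep tgt (src , zero , row2) u≢v true eq = R.separable (by-4-cycle λ ())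
  sep tgt (tgt , zero , row2) u≢v true eq = ⊥-elim (u≢v refl)
  sep tgt (tgt , zero , row3) u≢v true eq = R.separable (by-4-cycle λ ())

-- Tracing the cycles of a 2-factor

walk-map : ∀ {V W : Set} {R : V → V → Set} {S : W → W → Set} (h : V → W) → (∀ {v w} → R v w → S (h v) (h w)) →
  ∀ xs → Walk R xs → Walk S (map h xs)
walk-map h f []           _       = tt
walk-map h f (x ∷ [])     _       = tt
walk-map h f (x ∷ y ∷ xs) (r , w) = f r , walk-map h f (y ∷ xs) w

isCycle-map : ∀ {V W : Set} {R : V → V → Set} {S : W → W → Set} (h : V → W) →
  (∀ {v w} → h v ≡ h w → v ≡ w) → (∀ {v w} → R v w → S (h v) (h w)) →
  ∀ xs → IsCycle R xs → IsCycle S (map h xs)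
isCycle-map {S = S} h inj f (x ∷ xs) (len , unique , walk) =
    subst (3 ≤_) (sym (List.length-map h (x ∷ xs))) len
  , Unique.map⁺ inj unique
  , subst (Walk S) (List.map-++ h (x ∷ xs) (x ∷ [])) (walk-map h f (x ∷ xs ++ x ∷ []) walk)

unique-lookup-injective : ∀ {V : Set} {xs : List V} → Unique xs → ∀ i j → List.lookup xs i ≡ List.lookup xs j → i ≡ j
unique-lookup-injective (_ ∷ _) zero zero eq = refl
unique-lookup-injective {xs = x ∷ xs} (x≢ ∷ _) zero (suc j) eq = ⊥-elim (All¬⇒¬Any x≢ (subst (_∈ xs) (sym eq) (∈-lookup j)))
unique-lookup-injective {xs = x ∷ xs} (x≢ ∷ _) (suc i) zero eq = ⊥-elim (All¬⇒¬Any x≢ (subst (_∈ xs) eq (∈-lookup i)))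
unique-lookup-injective (_ ∷ u) (suc i) (suc j) eq = cong suc (unique-lookup-injective u i j eq)

unique⇒length≤ : ∀ {V : Set} {B} (ι : V → Fin B) → (∀ {v w} → ι v ≡ ι w → v ≡ w) →
  ∀ {xs} → Unique xs → length xs ≤ B
unique⇒length≤ ι inj unique = Fin.injective⇒≤ λ eq → unique-lookup-injective unique _ _ (inj eq)

module Adjacency (G : Graph) where
  open Graph G

  Adj : V → V → Set
  Adj v w = ∃ λ d → w ≡ nbr d v

  adj-sym : ∀ {v w} → Adj v w → Adj w v
  adj-sym (d , refl) = d , sym (nbr-invol d _)

module Extraction (G : Graph) (F : TwoCycles G) (simple : Graph.Simple G) (_≟_ : DecidableEquality (Graph.V G))
  {B : ℕ} (ι : Graph.V G → Fin B) (ι-injective : ∀ {v w} → ι v ≡ ι w → v ≡ w) where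
  open Graph G
  open Adjacency G
  open TwoCycles F
  open DecMembership _≟_ using (_∈?_)

  other-used : ∀ {v d e} → d ≢ omit v → e ≢ omit v → d ≢ e → e ≡ third (omit v) d
  other-used {v} {d} {e} d≢ e≢ d≢e = third-unique (omit v) d e (d≢ ∘ sym) e≢ (d≢e ∘ sym)

  -- A path x, z, ... back to x₀ all of whose inner vertices have both of their used neighbours on it.
  record Trail (x₀ x z : V) (xs : List V) : Set where
    field
      d         : Dir
      x≡        : x ≡ nbr d z
      d-used    : d ≢ omit z
      unique    : Unique (x ∷ z ∷ xs)
      close     : ∀ {y} → Adj x₀ y → Walk Adj (x ∷ z ∷ xs ++ y ∷ [])
      start∈    : x₀ ∈ z ∷ xs
      linked-x₀ : ∀ {y} → y ∈ x ∷ z ∷ xs → Linked omit x₀ y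
      inner     : ∀ {y} → y ∈ xs → y ≢ x₀ → ∀ e → e ≢ omit y → nbr e y ∈ z ∷ xs
      inner-z   : z ≢ x₀ → ∀ e → e ≢ omit z → nbr e z ∈ x ∷ z ∷ xs
      e₀        : Dir
      e₀-used   : e₀ ≢ omit x₀
      e₀∈       : nbr e₀ x₀ ∈ x ∷ z ∷ xs
      e₀-head   : x ≡ nbr e₀ x₀ → z ≡ x₀

  record ClosedTrail (x₀ : V) : Set where
    field
      cycle     : List V
      isCycle   : IsCycle Adj cycle
      start∈    : x₀ ∈ cycle
      linked-x₀ : ∀ {y} → y ∈ cycle → Linked omit x₀ y
      closed    : ∀ {y} → y ∈ cycle → ∀ e → e ≢ omit y → nbr e y ∈ cycle

    linked⇒∈ : ∀ {v w} → Linked omit v w → v ∈ cycle → w ∈ cycle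
    linked⇒∈ ε v∈ = v∈
    linked⇒∈ (use e e≢ ◅ r) v∈ = linked⇒∈ r (closed v∈ e e≢)

  module Extend {x₀ x z xs} (T : Trail x₀ x z xs) where
    open Trail T

    z≡ : z ≡ nbr d x
    z≡ = trans (sym (nbr-invol d z)) (cong (nbr d) (sym x≡))

    d-used-x : d ≢ omit x
    d-used-x = subst (λ v → d ≢ omit v) (sym x≡) (omit-back d-used)

    d′ : Dir
    d′ = third (omit x) d

    d′-used : d′ ≢ omit x
    d′-used = third-≢ˡ (omit x) d

    y : V
    y = nbr d′ x

    used-x : ∀ {P : V → Set} e → e ≢ omit x → P z → P y → P (nbr e x)
    used-x {P} e e≢ Pz Py with d ≟ᵈ e
    ... | yes refl = subst P z≡ Pz
    ... | no d≢e   = subst (λ e → P (nbr e x)) (sym (other-used d-used-x e≢ d≢e)) Py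

    x∉ : x ∉ z ∷ xs
    x∉ x∈ with x≢ ∷ _ ← unique = All¬⇒¬Any x≢ x∈

    z∉ : z ∉ xs
    z∉ z∈ with _ ∷ z≢ ∷ _ ← unique = All¬⇒¬Any z≢ z∈

    extend : y ∉ x ∷ z ∷ xs → Trail x₀ y x (z ∷ xs)
    extend y∉ = record
      { d = d′ ; x≡ = refl ; d-used = d′-used
      ; unique = ¬Any⇒All¬ _ y∉ ∷ unique
      ; close = λ adj → (d′ , sym (nbr-invol d′ x)) , close adj
      ; start∈ = there start∈
      ; linked-x₀ = λ { (here refl) → linked-x₀ (here refl) ◅◅ (use d′ d′-used ◅ ε) ; (there w∈) → linked-x₀ w∈ }
      ; inner = λ { (here refl) → inner-z ; (there w∈) w≢ e e≢ → there (inner w∈ w≢ e e≢) }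
      ; inner-z = λ _ e e≢ → used-x {λ w → w ∈ y ∷ x ∷ z ∷ xs} e e≢ (there (there (here refl))) (here refl)
      ; e₀ = e₀ ; e₀-used = e₀-used ; e₀∈ = there e₀∈
      ; e₀-head = λ eq → ⊥-elim (y∉ (subst (_∈ _) (sym eq) e₀∈)) }

    -- A vertex of `xs` other than `x₀` already has both of its used neighbours on the trail behind
    -- `x`; were it `y`, then `x` would occur twice. Absence of parallel edges rules out `z`.
    y≡x₀ : y ∈ x ∷ z ∷ xs → y ∈ xs × y ≡ x₀
    y≡x₀ (here eq) = ⊥-elim (nbr-irrefl d′ x eq)
    y≡x₀ (there (here eq)) = ⊥-elim (third-≢ʳ (omit x) d (simple x (trans eq z≡)))
    y≡x₀ (there (there y∈)) with y ≟ x₀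
    ... | yes eq = y∈ , eq
    ... | no y≢ = ⊥-elim (x∉ (subst (_∈ _) (nbr-invol d′ x) (inner y∈ y≢ d′ (omit-back d′-used))))

    -- The closing edge at `x₀` is not the first edge of the trail: otherwise `e₀-head` would give
    -- `z` = `x₀`, a repeated vertex. Hence `x₀` too has both used neighbours on the cycle.
    closing : y ∈ xs × y ≡ x₀ → ClosedTrail x₀
    closing (y∈ , y≡) = record
      { cycle = x ∷ z ∷ xs
      ; isCycle = s≤s (s≤s (nonempty y∈)) , unique , close (d′ , x≡′)
      ; start∈ = there start∈
      ; linked-x₀ = linked-x₀
      ; closed = closed }
      where
      nonempty : ∀ {v} {vs : List V} → v ∈ vs → 1 ≤ length vs
      nonempty (here _)  = s≤s z≤n
      nonempty (there _) = s≤s z≤n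
      x≡′ : x ≡ nbr d′ x₀
      x≡′ = trans (sym (nbr-invol d′ x)) (cong (nbr d′) y≡)
      z≢x₀ : z ≢ x₀
      z≢x₀ eq = z∉ (subst (_∈ xs) (trans y≡ (sym eq)) y∈)
      d′-used-x₀ : d′ ≢ omit x₀
      d′-used-x₀ = subst (λ v → d′ ≢ omit v) y≡ (omit-back d′-used)
      closed-x₀ : ∀ e → e ≢ omit x₀ → nbr e x₀ ∈ x ∷ z ∷ xs
      closed-x₀ e e≢ with e₀ ≟ᵈ e
      ... | yes refl = e₀∈
      ... | no e₀≢e  = subst (_∈ x ∷ z ∷ xs) (cong (λ e → nbr e x₀)
                         (trans (other-used e₀-used d′-used-x₀ e₀≢d′) (sym (other-used e₀-used e≢ e₀≢e))))
                         (here (sym x≡′))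
        where
        e₀≢d′ : e₀ ≢ d′
        e₀≢d′ eq = z≢x₀ (e₀-head (trans x≡′ (cong (λ e → nbr e x₀) (sym eq))))
      closed : ∀ {w} → w ∈ x ∷ z ∷ xs → ∀ e → e ≢ omit w → nbr e w ∈ x ∷ z ∷ xs
      closed (here refl) e e≢ = used-x {λ w → w ∈ x ∷ z ∷ xs} e e≢ (there (here refl)) (there (there y∈))
      closed (there (here refl)) = inner-z z≢x₀
      closed {w} (there (there w∈)) e e≢ with w ≟ x₀
      ... | yes refl = closed-x₀ e e≢
      ... | no w≢    = there (inner w∈ w≢ e e≢)

  -- The vertices of a trail are distinct and inject into `Fin B`, so the trail must close before
  -- the fuel is spent.
  follow : ∀ fuel {x₀ x z xs} → Trail x₀ x z xs → B < length (x ∷ z ∷ xs) + fuel → ClosedTrail x₀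
  follow zero T lt = ⊥-elim (ℕ.<⇒≱ (subst (B <_) (ℕ.+-identityʳ _) lt) (unique⇒length≤ ι ι-injective (Trail.unique T)))
  follow (suc fuel) {x = x} {z} {xs} T lt with Extend.y T ∈? x ∷ z ∷ xs
  ... | yes y∈ = Extend.closing T (Extend.y≡x₀ T y∈)
  ... | no y∉  = follow fuel (Extend.extend T y∉) (subst (B <_) (ℕ.+-suc _ fuel) lt)

  trail : ∀ x₀ → ClosedTrail x₀
  trail x₀ = follow B first (ℕ.m≤n+m (suc B) 1)
    where
    e : Dir
    e = third (omit x₀) (omit x₀)
    e-used : e ≢ omit x₀
    e-used = third-≢ˡ (omit x₀) (omit x₀)
    first : Trail x₀ (nbr e x₀) x₀ []
    first = record
      { d = e ; x≡ = refl ; d-used = e-used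
      ; unique = (nbr-irrefl e x₀ ∷ []) ∷ [] ∷ []
      ; close = λ adj → (e , sym (nbr-invol e x₀)) , adj , tt
      ; start∈ = here refl
      ; linked-x₀ = λ { (here refl) → use e e-used ◅ ε ; (there (here refl)) → ε }
      ; inner = λ ()
      ; inner-z = λ x₀≢ → ⊥-elim (x₀≢ refl)
      ; e₀ = e ; e₀-used = e-used ; e₀∈ = here refl ; e₀-head = λ _ → refl }

  module C v = ClosedTrail (trail v)

  twoCycleFactor : ∀ u v → colour u ≢ colour v → TwoCycleFactor Adj (C.cycle u) (C.cycle v)
  twoCycleFactor u v u≢v = C.isCycle u , C.isCycle v , cover , disjoint
    where
    cover : ∀ w → w ∈ C.cycle u ⊎ w ∈ C.cycle v
    cover w with colour u Bool.≟ colour w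
    ... | yes eq = inj₁ (C.linked⇒∈ u (linked u w eq) (C.start∈ u))
    ... | no u≢w = inj₂ (C.linked⇒∈ v (linked v w (same u≢v u≢w)) (C.start∈ v))
      where
      same : ∀ {a b c : Bool} → a ≢ b → a ≢ c → b ≡ c
      same a≢b a≢c = trans (Bool.¬-not (a≢b ∘ sym)) (sym (Bool.¬-not (a≢c ∘ sym)))
    disjoint : ∀ w → w ∈ C.cycle u → w ∈ C.cycle v → ⊥
    disjoint w w∈u w∈v = u≢v (trans (linked-colour (C.linked-x₀ u w∈u)) (sym (linked-colour (C.linked-x₀ v w∈v))))

-- From a pair of cyclic lists to an omitted matching

data Consecutive {V : Set} (v w : V) : List V → Set where
  here  : ∀ {xs} → Consecutive v w (v ∷ w ∷ xs)
  there : ∀ {x xs} → Consecutive v w xs → Consecutive v w (x ∷ xs)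

module _ {V : Set} where

  next-exists : ∀ {v z : V} x xs → v ∈ x ∷ xs → ∃ λ w → Consecutive v w (x ∷ xs ++ z ∷ [])
  next-exists x []       (here refl) = _ , here
  next-exists x (y ∷ xs) (here refl) = y , here
  next-exists x (y ∷ xs) (there v∈)  = let w , c = next-exists y xs v∈ in w , there c

  previous-exists : ∀ {v x : V} ys → v ∈ ys → ∃ λ w → Consecutive w v (x ∷ ys)
  previous-exists (y ∷ ys) (here refl) = _ , here
  previous-exists (y ∷ ys) (there v∈)  = let w , c = previous-exists ys v∈ in w , there c

  next∈ : ∀ {v w x : V} {ys} → Consecutive v w (x ∷ ys) → w ∈ ys
  next∈ here = here refl
  next∈ {ys = _ ∷ _} (there c) = there (next∈ c)

  previous∈ : ∀ {v w z : V} xs → Consecutive v w (xs ++ z ∷ []) → v ∈ xs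
  previous∈ [] (there ())
  previous∈ (x ∷ []) here               = here refl
  previous∈ (x ∷ []) (there (there ()))
  previous∈ (x ∷ y ∷ xs) here           = here refl
  previous∈ (x ∷ y ∷ xs) (there c)      = there (previous∈ (y ∷ xs) c)

  next-unique : ∀ {v w w′ z : V} xs → Unique xs → Consecutive v w (xs ++ z ∷ []) → Consecutive v w′ (xs ++ z ∷ []) → w ≡ w′
  next-unique [] _ (there ()) _
  next-unique (x ∷ []) _ here here = refl
  next-unique (x ∷ []) _ here (there (there ()))
  next-unique (x ∷ []) _ (there (there ())) _
  next-unique (x ∷ y ∷ xs) _ here here = refl
  next-unique (x ∷ y ∷ xs) (x∉ ∷ _) here (there c) = ⊥-elim (All¬⇒¬Any x∉ (previous∈ (y ∷ xs) c))
  next-unique (x ∷ y ∷ xs) (x∉ ∷ _) (there c) here = ⊥-elim (All¬⇒¬Any x∉ (previous∈ (y ∷ xs) c))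
  next-unique (x ∷ y ∷ xs) (_ ∷ u) (there c) (there c′) = next-unique (y ∷ xs) u c c′

  previous-unique : ∀ {v w w′ x : V} ys → Unique ys → Consecutive w v (x ∷ ys) → Consecutive w′ v (x ∷ ys) → w ≡ w′
  previous-unique (y ∷ ys) _ here here = refl
  previous-unique (y ∷ ys) (y∉ ∷ u) here (there c) = ⊥-elim (All¬⇒¬Any y∉ (next∈ c))
  previous-unique (y ∷ ys) (y∉ ∷ u) (there c) here = ⊥-elim (All¬⇒¬Any y∉ (next∈ c))
  previous-unique (y ∷ ys) (y∉ ∷ u) (there c) (there c′) = previous-unique ys u c c′

  -- With `z` equal to `x` the list is a cycle, and a property that passes to successors is carried
  -- from any vertex round to the head.
  propagate : ∀ {z v : V} {P : V → Set} x xs → (∀ {a b} → Consecutive a b (x ∷ xs ++ z ∷ []) → P a → P b) →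
    v ∈ x ∷ xs → P v → P z
  propagate x []       step (here refl) Pv = step here Pv
  propagate x (y ∷ xs) step (here refl) Pv = propagate y xs (step ∘ there) (here refl) (step here Pv)
  propagate x (y ∷ xs) step (there v∈)  Pv = propagate y xs (step ∘ there) v∈ Pv

  three-into-two : ∀ {a b c v w : V} → a ≢ b → b ≢ c → a ≢ c → a ≡ v ⊎ a ≡ w → b ≡ v ⊎ b ≡ w → c ≡ v ⊎ c ≡ w → ⊥
  three-into-two a≢b b≢c a≢c (inj₁ p) (inj₁ q) _        = a≢b (trans p (sym q))
  three-into-two a≢b b≢c a≢c (inj₂ p) (inj₂ q) _        = a≢b (trans p (sym q))
  three-into-two a≢b b≢c a≢c (inj₁ p) (inj₂ q) (inj₁ r) = a≢c (trans p (sym r))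
  three-into-two a≢b b≢c a≢c (inj₁ p) (inj₂ q) (inj₂ r) = b≢c (trans q (sym r))
  three-into-two a≢b b≢c a≢c (inj₂ p) (inj₁ q) (inj₁ r) = b≢c (trans q (sym r))
  three-into-two a≢b b≢c a≢c (inj₂ p) (inj₁ q) (inj₂ r) = a≢c (trans p (sym r))

  close-up : List V → List V
  close-up []       = []
  close-up (x ∷ xs) = x ∷ xs ++ x ∷ []

  -- If w both follows and precedes v, then going round the cycle never leaves {v , w}.
  next≢previous : ∀ {v w : V} C → 3 ≤ length C → Unique C → v ∈ C →
    Consecutive v w (close-up C) → Consecutive w v (close-up C) → ⊥
  next≢previous (_ ∷ []) (s≤s ())
  next≢previous (_ ∷ _ ∷ []) (s≤s (s≤s ()))
  next≢previous {v} {w} C@(x ∷ y ∷ z ∷ xs) _ u@((x≢y ∷ x≢z ∷ _) ∷ (y≢z ∷ _) ∷ _) v∈ vw wv =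
    three-into-two x≢y y≢z x≢z Sx Sy (step (there here) Sy)
    where
    S : V → Set
    S a = a ≡ v ⊎ a ≡ w
    step : ∀ {a b} → Consecutive a b (close-up C) → S a → S b
    step c (inj₁ refl) = inj₂ (next-unique C u c vw)
    step c (inj₂ refl) = inj₁ (next-unique C u c wv)
    Sx : S x
    Sx = propagate x _ step v∈ (inj₁ refl)
    Sy : S y
    Sy = step here Sx

module FromCycles (G : Graph) (simple : Graph.Simple G) where
  open Graph G
  open Adjacency G

  walk⇒adj : ∀ {v w} xs → Walk Adj xs → Consecutive v w xs → Adj v w
  walk⇒adj (x ∷ y ∷ xs) (a , _) here      = a
  walk⇒adj (x ∷ y ∷ xs) (_ , w) (there c) = walk⇒adj (y ∷ xs) w c

  Edge : List V → V → V → Set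
  Edge C v w = Consecutive v w (close-up C) ⊎ Consecutive w v (close-up C)

  edge-sym : ∀ {C v w} → Edge C v w → Edge C w v
  edge-sym (inj₁ c) = inj₂ c
  edge-sym (inj₂ c) = inj₁ c

  close-up-unique : ∀ {x : V} {xs} → Unique (x ∷ xs) → Unique (xs ++ x ∷ [])
  close-up-unique (x∉ ∷ u) = Unique.++⁺ u ([] ∷ []) λ { (v∈ , here refl) → All¬⇒¬Any x∉ v∈ }

  rotate∈ : ∀ {v x : V} {xs} → v ∈ x ∷ xs → v ∈ xs ++ x ∷ []
  rotate∈ {xs = xs} (here refl) = ∈-++⁺ʳ xs (here refl)
  rotate∈ (there v∈) = ∈-++⁺ˡ v∈

  unrotate∈ : ∀ {v x : V} xs → v ∈ xs ++ x ∷ [] → v ∈ x ∷ xs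
  unrotate∈ xs v∈ with ∈-++⁻ xs v∈
  ... | inj₁ v∈xs = there v∈xs
  ... | inj₂ (here refl) = here refl

  edge∈ : ∀ {v w} C → Edge C v w → v ∈ C
  edge∈ [] (inj₁ ())
  edge∈ [] (inj₂ ())
  edge∈ (x ∷ xs) (inj₁ c) = previous∈ (x ∷ xs) c
  edge∈ (x ∷ xs) (inj₂ c) = unrotate∈ xs (next∈ c)

  record Omitted (C : List V) (v : V) : Set where
    field
      omitted : Dir
      kept    : ∀ d → d ≢ omitted → Edge C v (nbr d v)
      avoided : ¬ Edge C v (nbr omitted v)

  omitted : ∀ C → IsCycle Adj C → ∀ {v} → v ∈ C → Omitted C v
  omitted C@(x ∷ xs) (len , u , walk) {v} v∈
    with w , vw ← next-exists {z = x} x xs v∈ | w′ , w′v ← previous-exists {x = x} (xs ++ x ∷ []) (rotate∈ v∈)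
    with walk⇒adj (close-up C) walk vw | adj-sym (walk⇒adj (close-up C) walk w′v)
  ... | d , refl | d′ , refl = record
    { omitted = third d d′
    ; kept = kept
    ; avoided = avoided }
    where
    d≢d′ : d ≢ d′
    d≢d′ refl = next≢previous C len u v∈ vw w′v
    kept : ∀ e → e ≢ third d d′ → Edge C v (nbr e v)
    kept e e≢ with e ≟ᵈ d | e ≟ᵈ d′
    ... | yes refl | _        = inj₁ vw
    ... | no _     | yes refl = inj₂ w′v
    ... | no e≢d   | no e≢d′  = ⊥-elim (e≢ (third-unique d d′ e d≢d′ e≢d e≢d′))
    avoided : ¬ Edge C v (nbr (third d d′) v)
    avoided (inj₁ c) = third-≢ˡ d d′ (simple v (next-unique C u c vw))
    avoided (inj₂ c) = third-≢ʳ d d′ (simple v (previous-unique (xs ++ x ∷ []) (close-up-unique u) c w′v))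

  module _ (C₁ C₂ : List V) (factor : TwoCycleFactor Adj C₁ C₂) where
    private
      cycle₁ = proj₁ factor
      cycle₂ = proj₁ (proj₂ factor)
      cover = proj₁ (proj₂ (proj₂ factor))
      disjoint = proj₂ (proj₂ (proj₂ factor))

    side : ∀ {v} → v ∈ C₁ ⊎ v ∈ C₂ → Bool
    side (inj₁ _) = true
    side (inj₂ _) = false

    cyc : Bool → List V
    cyc true  = C₁
    cyc false = C₂

    isCycle : ∀ b → IsCycle Adj (cyc b)
    isCycle true  = cycle₁
    isCycle false = cycle₂

    colour : V → Bool
    colour v = side (cover v)

    colour∈ : ∀ v → v ∈ cyc (colour v)
    colour∈ v with cover v
    ... | inj₁ v∈ = v∈
    ... | inj₂ v∈ = v∈

    ∈-colour : ∀ b {v} → v ∈ cyc b → colour v ≡ b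
    ∈-colour b {v} v∈ with cover v
    ∈-colour true  v∈ | inj₁ _   = refl
    ∈-colour true  v∈ | inj₂ v∈′ = ⊥-elim (disjoint _ v∈ v∈′)
    ∈-colour false v∈ | inj₁ v∈′ = ⊥-elim (disjoint _ v∈′ v∈)
    ∈-colour false v∈ | inj₂ _   = refl

    at : ∀ v → Omitted (cyc (colour v)) v
    at v = omitted (cyc (colour v)) (isCycle (colour v)) (colour∈ v)

    omit : V → Dir
    omit v = Omitted.omitted (at v)

    colour-nbr : ∀ v d → d ≢ omit v → colour (nbr d v) ≡ colour v
    colour-nbr v d d≢ = ∈-colour _ (edge∈ (cyc (colour v)) (edge-sym {cyc (colour v)} (Omitted.kept (at v) d d≢)))

    -- If the other end kept this edge, the edge would lie on the cycle through that end; this cycle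
    -- then contains `v` as well, so `v` would not avoid the edge.
    omit-nbr : ∀ v → omit (nbr (omit v) v) ≡ omit v
    omit-nbr v with omit v ≟ᵈ omit (nbr (omit v) v)
    ... | yes eq = sym eq
    ... | no ≢ = ⊥-elim (Omitted.avoided (at v) (subst (λ b → Edge (cyc b) v w) (sym same) (edge-sym {cyc (colour w)} back)))
      where
      w : V
      w = nbr (omit v) v
      back : Edge (cyc (colour w)) w v
      back = subst (Edge (cyc (colour w)) w) (nbr-invol (omit v) v) (Omitted.kept (at w) (omit v) ≢)
      same : colour v ≡ colour w
      same = ∈-colour _ (edge∈ (cyc (colour w)) (edge-sym {cyc (colour w)} back))

    open Matching omit omit-nbr

    edge⇒used : ∀ b {v w} → Edge (cyc b) v w → Adj v w → Used omit v w
    edge⇒used b {v} e (d , refl) = use d λ { refl →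
      Omitted.avoided (at v) (subst (λ b → Edge (cyc b) v _) (sym (∈-colour b (edge∈ (cyc b) e))) e) }

    along : ∀ x xs → (∀ {v w} → Consecutive v w (x ∷ xs) → Used omit v w) → ∀ {v} → v ∈ x ∷ xs → Linked omit x v
    along x xs step (here refl) = ε
    along x (y ∷ xs) step (there v∈) = step here ◅ along y xs (step ∘ there) v∈

    cycle-linked : ∀ b {v w} → v ∈ cyc b → w ∈ cyc b → Linked omit v w
    cycle-linked b = go (cyc b) (isCycle b) λ c → edge⇒used b (inj₁ c)
      where
      go : ∀ C → IsCycle Adj C → (∀ {v w} → Consecutive v w (close-up C) → Adj v w → Used omit v w) →
           ∀ {v w} → v ∈ C → w ∈ C → Linked omit v w
      go C@(x ∷ xs) (_ , _ , walk) used v∈ w∈ = linked-sym (from-head v∈) ◅◅ from-head w∈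
        where
        from-head : ∀ {v} → v ∈ x ∷ xs → Linked omit x v
        from-head v∈ = along x (xs ++ x ∷ []) (λ c → used c (walk⇒adj (close-up C) walk c)) (∈-++⁺ˡ v∈)

    twoCycles : TwoCycles G
    twoCycles = record
      { omit = omit ; omit-nbr = omit-nbr ; colour = colour ; colour-nbr = colour-nbr
      ; linked = λ v w eq → cycle-linked (colour w) (subst (λ b → v ∈ cyc b) eq (colour∈ v)) (colour∈ w) }

-- Realisations of an abstract cubic graph

module Realisation (G : Graph) (simple : Graph.Simple G) (_≟_ : DecidableEquality (Graph.V G))
  {W : Set} (AdjW : W → W → Set) (φ : Graph.V G → W) (ψ : W → Graph.V G)
  (φ-ψ : ∀ w → φ (ψ w) ≡ w) (ψ-φ : ∀ v → ψ (φ v) ≡ v)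
  (adj⁺ : ∀ {v w} → Adjacency.Adj G v w → AdjW (φ v) (φ w))
  (adj⁻ : ∀ {v w} → AdjW (φ v) (φ w) → Adjacency.Adj G v w)
  {B : ℕ} (ι : W → Fin B) (ι-injective : ∀ {v w} → ι v ≡ ι w → v ≡ w) where
  open Graph G
  open Adjacency G

  φ-injective : ∀ {v w} → φ v ≡ φ w → v ≡ w
  φ-injective {v} {w} eq = trans (sym (ψ-φ v)) (trans (cong ψ eq) (ψ-φ w))

  ψ-injective : ∀ {v w} → ψ v ≡ ψ w → v ≡ w
  ψ-injective {v} {w} eq = trans (sym (φ-ψ v)) (trans (cong φ eq) (φ-ψ w))

  ψ-adj : ∀ {v w} → AdjW v w → Adj (ψ v) (ψ w)
  ψ-adj {v} {w} a = adj⁻ (subst₂ AdjW (sym (φ-ψ v)) (sym (φ-ψ w)) a)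

  ∈-map-φ : ∀ {w C} → ψ w ∈ C → w ∈ map φ C
  ∈-map-φ {w} {C} ψw∈ = subst (_∈ map φ C) (φ-ψ w) (∈-map⁺ φ ψw∈)

  ∈-map-φ⁻ : ∀ {w C} → w ∈ map φ C → ψ w ∈ C
  ∈-map-φ⁻ {w} {C} w∈ with v , v∈ , refl ← ∈-map⁻ φ w∈ = subst (_∈ C) (sym (ψ-φ v)) v∈

  ∈-map-ψ : ∀ {v C} → φ v ∈ C → v ∈ map ψ C
  ∈-map-ψ {v} {C} φv∈ = subst (_∈ map ψ C) (ψ-φ v) (∈-map⁺ ψ φv∈)

  ∈-map-ψ⁻ : ∀ {v C} → v ∈ map ψ C → φ v ∈ C
  ∈-map-ψ⁻ {v} {C} v∈ with w , w∈ , refl ← ∈-map⁻ ψ v∈ = subst (_∈ C) (sym (φ-ψ w)) w∈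

  allSeparable⇒cyclable : AllSeparable G → TwoSpanningCyclable AdjW
  allSeparable⇒cyclable all u v u≢v with F , u≢ᶜv ← all (ψ u) (ψ v) (u≢v ∘ ψ-injective) =
    let open Extraction G F simple _≟_ (ι ∘ φ) (φ-injective ∘ ι-injective)
        c₁ , c₂ , cover , disjoint = twoCycleFactor (ψ u) (ψ v) u≢ᶜv
    in map φ (C.cycle (ψ u)) , map φ (C.cycle (ψ v)) ,
       ( isCycle-map φ φ-injective adj⁺ _ c₁ , isCycle-map φ φ-injective adj⁺ _ c₂
       , (λ w → [ inj₁ ∘ ∈-map-φ , inj₂ ∘ ∈-map-φ ]′ (cover (ψ w)))
       , λ w w∈₁ w∈₂ → disjoint (ψ w) (∈-map-φ⁻ w∈₁) (∈-map-φ⁻ w∈₂) ) ,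
       ∈-map-φ (C.start∈ (ψ u)) , ∈-map-φ (C.start∈ (ψ v))

  cyclable⇒allSeparable : TwoSpanningCyclable AdjW → AllSeparable G
  cyclable⇒allSeparable cyc u v u≢v
    with C₁ , C₂ , (c₁ , c₂ , cover , disjoint) , u∈ , v∈ ← cyc (φ u) (φ v) (u≢v ∘ φ-injective) =
    FromCycles.twoCycles G simple _ _ factor , λ eq → true≢false (trans (sym (∈-colour true (∈-map-ψ u∈))) (trans eq (∈-colour false (∈-map-ψ v∈))))
    where
    true≢false : true ≢ false
    true≢false ()
    factor : TwoCycleFactor Adj (map ψ C₁) (map ψ C₂)
    factor = isCycle-map ψ ψ-injective ψ-adj C₁ c₁ , isCycle-map ψ ψ-injective ψ-adj C₂ c₂
           , (λ v → [ inj₁ ∘ ∈-map-ψ , inj₂ ∘ ∈-map-ψ ]′ (cover (φ v)))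
           , λ v v∈₁ v∈₂ → disjoint (φ v) (∈-map-ψ⁻ v∈₁) (∈-map-ψ⁻ v∈₂)
    ∈-colour = FromCycles.∈-colour G simple _ _ factor

  cyclable⇔allSeparable : TwoSpanningCyclable AdjW ⇔ AllSeparable G
  cyclable⇔allSeparable = mk⇔ cyclable⇒allSeparable allSeparable⇒cyclable

-- Tori without parallel edges

s-≢ : ∀ {n} (a : Fin (2 + n)) → s a ≢ a
s-≢ a eq with view a
s-≢ _ () | ‵fromℕ
s-≢ _ eq | ‵inject₁ j = ℕ.1+n≢n (trans (cong toℕ eq) (Fin.toℕ-inject₁ j))

s-s-≢ : ∀ {n} (a : Fin (3 + n)) → s (s a) ≢ a
s-s-≢ a eq with view a
s-s-≢ _ () | ‵fromℕ
s-s-≢ _ eq | ‵inject₁ j with view j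
s-s-≢ _ () | ‵inject₁ _ | ‵fromℕ
s-s-≢ _ eq | ‵inject₁ _ | ‵inject₁ i = ℕ.m≢1+n+m (toℕ i) {1}
  (sym (trans (cong toℕ eq) (trans (Fin.toℕ-inject₁ (inject₁ i)) (Fin.toℕ-inject₁ i))))

-- Parallel edges at a target are parallel at the source where they end, so sources suffice.
injective⇒simple : (G : Graph) → (∀ d e x → Graph.to G d x ≡ Graph.to G e x → d ≡ e) → Graph.Simple G
injective⇒simple G inj {d} {e} (src , x) eq = inj d e x (cong proj₂ eq)
injective⇒simple G inj {d} {e} (tgt , x) eq = inj d e (from d x)
  (trans (to-from d x) (trans (sym (to-from e x)) (cong (to e) (sym (cong proj₂ eq)))))
  where open Graph G

distinct⇒injective : {A : Set} (f : Dir → A) → f α ≢ f β → f β ≢ f γ → f α ≢ f γ → ∀ d e → f d ≡ f e → d ≡ e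
distinct⇒injective f αβ βγ αγ α α eq = refl
distinct⇒injective f αβ βγ αγ α β eq = ⊥-elim (αβ eq)
distinct⇒injective f αβ βγ αγ α γ eq = ⊥-elim (αγ eq)
distinct⇒injective f αβ βγ αγ β α eq = ⊥-elim (αβ (sym eq))
distinct⇒injective f αβ βγ αγ β β eq = refl
distinct⇒injective f αβ βγ αγ β γ eq = ⊥-elim (βγ eq)
distinct⇒injective f αβ βγ αγ γ α eq = ⊥-elim (αγ (sym eq))
distinct⇒injective f αβ βγ αγ γ β eq = ⊥-elim (βγ (sym eq))
distinct⇒injective f αβ βγ αγ γ γ eq = refl

hop-column : ∀ m {n} (τ : Twist n) x → proj₁ (hop m τ x) ≡ s (proj₁ x)
hop-column m τ (c , a) with view c
... | ‵fromℕ     = refl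
... | ‵inject₁ j = refl

simple-torus : ∀ m {n} (τ : Twist (suc n)) → Graph.Simple (Torus (suc m) τ)
simple-torus m τ = injective⇒simple (Torus (suc m) τ) λ d e x@(c , a) →
  distinct⇒injective (λ d → Graph.to (Torus (suc m) τ) d x)
    (λ eq → s-≢ a (sym (cong proj₂ eq)))
    (λ eq → s-≢ c (sym (trans (cong proj₁ eq) (hop-column (suc m) τ x))))
    (λ eq → s-≢ c (sym (trans (cong proj₁ eq) (hop-column (suc m) τ x)))) d e

simple-one-column : ∀ n → Graph.Simple (Torus 0 {2 + n} (s-power 2))
simple-one-column n = injective⇒simple (Torus 0 (s-power 2)) λ { d e x@(zero , a) →
  distinct⇒injective (λ d → Graph.to (Torus 0 (s-power 2)) d x)
    (λ eq → s-≢ a (sym (cong proj₂ eq)))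
    (λ eq → s-≢ (s a) (sym (cong proj₂ eq)))
    (λ eq → s-s-≢ a (sym (cong proj₂ eq))) d e }

-- Honeycomb toroidal graphs as sheared tori

infixr 8 s^_
s^_ : ∀ {n} → ℕ → Fin (suc n) → Fin (suc n)
s^ k = Twist.K (s-power k)

s-wraps : ∀ {n} (x : Fin (suc n)) → ∃ λ q → suc (toℕ x) ≡ toℕ (s x) + q * suc n
s-wraps {n} x with view x
... | ‵fromℕ     = 1 , trans (cong suc (Fin.toℕ-fromℕ n)) (sym (ℕ.+-identityʳ (suc n)))
... | ‵inject₁ j = 0 , trans (cong suc (Fin.toℕ-inject₁ j)) (sym (ℕ.+-identityʳ _))

s^-wraps : ∀ {n} k (x : Fin (suc n)) → ∃ λ q → k + toℕ x ≡ toℕ ((s^ k) x) + q * suc n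
s^-wraps zero x = 0 , sym (ℕ.+-identityʳ _)
s^-wraps {n} (suc k) x with q , eq ← s^-wraps k x | q′ , eq′ ← s-wraps ((s^ k) x) = q′ + q , (begin
  suc (k + toℕ x)                                  ≡⟨ cong suc eq ⟩
  suc (toℕ ((s^ k) x)) + q * suc n                 ≡⟨ cong (_+ q * suc n) eq′ ⟩
  toℕ ((s^ suc k) x) + q′ * suc n + q * suc n      ≡⟨ ℕ.+-assoc (toℕ ((s^ suc k) x)) _ _ ⟩
  toℕ ((s^ suc k) x) + (q′ * suc n + q * suc n)    ≡⟨ cong (toℕ ((s^ suc k) x) +_) (ℕ.*-distribʳ-+ (suc n) q′ q) ⟨
  toℕ ((s^ suc k) x) + (q′ + q) * suc n            ∎)

congMod-s^ : ∀ {n} k (x : Fin (suc n)) → CongMod (suc n) (toℕ ((s^ k) x)) (toℕ x + k)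
congMod-s^ k x with q , eq ← s^-wraps k x = q , inj₂ (trans (ℕ.+-comm (toℕ x) k) eq)

congMod⇒% : ∀ {n a b} → CongMod (suc n) a b → a % suc n ≡ b % suc n
congMod⇒% {n} {b = b} (q , inj₁ refl) = [m+kn]%n≡m%n b q (suc n)
congMod⇒% {n} {a} (q , inj₂ refl) = sym ([m+kn]%n≡m%n a q (suc n))

congMod⇒≡s^ : ∀ {n} k (x y : Fin (suc n)) → CongMod (suc n) (toℕ y) (toℕ x + k) → y ≡ (s^ k) x
congMod⇒≡s^ {n} k x y c = Fin.toℕ-injective (begin
  toℕ y                       ≡⟨ m<n⇒m%n≡m (Fin.toℕ<n y) ⟨
  toℕ y % suc n               ≡⟨ congMod⇒% c ⟩
  (toℕ x + k) % suc n         ≡⟨ congMod⇒% (congMod-s^ k x) ⟨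
  toℕ ((s^ k) x) % suc n      ≡⟨ m<n⇒m%n≡m (Fin.toℕ<n ((s^ k) x)) ⟩
  toℕ ((s^ k) x)              ∎)

-- Every edge is oriented from left to right or upwards.
module _ (m n ℓ : ℕ) where

  Forward : Vertex m n → Vertex m n → Set
  Forward (i , j) (i′ , j′) =
      (toℕ i ≡ toℕ i′ × CongMod n (toℕ j′) (toℕ j + 1))
    ⊎ (toℕ j ≡ toℕ j′ × suc (toℕ i) ≡ toℕ i′ × (toℕ i + toℕ j) % 2 ≡ 1)
    ⊎ (suc (toℕ i) ≡ m × toℕ i′ ≡ 0 × toℕ j % 2 ≡ m % 2 × CongMod n (toℕ j′) (toℕ j + ℓ))

  forward⇒adj : ∀ {v w} → v ≢ w → Forward v w → HTGAdj m n ℓ v w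
  forward⇒adj v≢w (inj₁ (eq , c))               = v≢w , inj₁ (eq , inj₁ c)
  forward⇒adj v≢w (inj₂ (inj₁ (eq , e , odd)))  = v≢w , inj₂ (inj₁ (eq , inj₁ (e , odd)))
  forward⇒adj v≢w (inj₂ (inj₂ jump))            = v≢w , inj₂ (inj₂ (inj₁ jump))

  backward⇒adj : ∀ {v w} → v ≢ w → Forward w v → HTGAdj m n ℓ v w
  backward⇒adj v≢w (inj₁ (eq , c))              = v≢w , inj₁ (sym eq , inj₂ c)
  backward⇒adj v≢w (inj₂ (inj₁ (eq , e , odd))) = v≢w , inj₂ (inj₁ (sym eq , inj₂ (e , odd)))
  backward⇒adj v≢w (inj₂ (inj₂ jump))           = v≢w , inj₂ (inj₂ (inj₂ jump))

  adj⇒forward : ∀ {v w} → HTGAdj m n ℓ v w → Forward v w ⊎ Forward w v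
  adj⇒forward (_ , inj₁ (eq , inj₁ c))                     = inj₁ (inj₁ (eq , c))
  adj⇒forward (_ , inj₁ (eq , inj₂ c))                     = inj₂ (inj₁ (sym eq , c))
  adj⇒forward (_ , inj₂ (inj₁ (eq , inj₁ (e , odd))))      = inj₁ (inj₂ (inj₁ (eq , e , odd)))
  adj⇒forward (_ , inj₂ (inj₁ (eq , inj₂ (e , odd))))      = inj₂ (inj₂ (inj₁ (sym eq , e , odd)))
  adj⇒forward (_ , inj₂ (inj₂ (inj₁ jump)))                = inj₁ (inj₂ (inj₂ jump))
  adj⇒forward (_ , inj₂ (inj₂ (inj₂ jump)))                = inj₂ (inj₂ (inj₂ jump))

bit : Side → Fin 2
bit tgt = zero
bit src = suc zero

side : Fin 2 → Side
side zero       = tgt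
side (suc zero) = src

-- The source and the target (c , a) are the vertices u_{c, c+2a+1} and u_{c, c+2a}.
module HTG (h n : ℕ) where
  τ : Twist n
  τ = s-power (2 + h)
  open Graph (Torus (h * 2) τ)
  open Adjacency (Torus (h * 2) τ)

  Row : Set
  Row = Fin (suc n * 2)

  height : Side → Fin (suc n) → Row
  height x a = combine a (bit x)

  toℕ-height : ∀ x a → toℕ (height x a) ≡ 2 * toℕ a + toℕ (bit x)
  toℕ-height x a = Fin.toℕ-combine a (bit x)

  height-src : ∀ a → height src a ≡ s (height tgt a)
  height-src a = congMod⇒≡s^ 1 (height tgt a) (height src a) (0 , inj₁ (begin
    toℕ (height src a)            ≡⟨ toℕ-height src a ⟩
    2 * toℕ a + 1                 ≡⟨ lemma (toℕ a) ⟩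
    2 * toℕ a + 0 + 1 + 0         ≡⟨ cong (λ t → t + 1 + 0) (toℕ-height tgt a) ⟨
    toℕ (height tgt a) + 1 + 0    ∎))
    where
    lemma : ∀ t → 2 * t + 1 ≡ 2 * t + 0 + 1 + 0
    lemma = solve-∀

  height-tgt : ∀ a → height tgt (s a) ≡ s (height src a)
  height-tgt a with q , eq ← s-wraps a = congMod⇒≡s^ 1 (height src a) (height tgt (s a)) (q , inj₂ (begin
    toℕ (height src a) + 1                      ≡⟨ cong (_+ 1) (toℕ-height src a) ⟩
    2 * toℕ a + 1 + 1                           ≡⟨ double-suc (toℕ a) ⟩
    2 * suc (toℕ a) + 0                         ≡⟨ cong (λ t → 2 * t + 0) eq ⟩
    2 * (toℕ (s a) + q * suc n) + 0             ≡⟨ double-sum (toℕ (s a)) q (suc n) ⟩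
    2 * toℕ (s a) + 0 + q * (suc n * 2)         ≡⟨ cong (_+ q * (suc n * 2)) (toℕ-height tgt (s a)) ⟨
    toℕ (height tgt (s a)) + q * (suc n * 2)    ∎))
    where
    double-suc : ∀ t → 2 * t + 1 + 1 ≡ 2 * suc t + 0
    double-suc = solve-∀
    double-sum : ∀ t q N → 2 * (t + q * N) + 0 ≡ 2 * t + 0 + q * (N * 2)
    double-sum = solve-∀

  height-s^ : ∀ k a → height tgt ((s^ k) a) ≡ (s^ (k * 2)) (height tgt a)
  height-s^ zero a = refl
  height-s^ (suc k) a = begin
    height tgt (s ((s^ k) a))          ≡⟨ height-tgt ((s^ k) a) ⟩
    s (height src ((s^ k) a))          ≡⟨ cong s (height-src ((s^ k) a)) ⟩
    s (s (height tgt ((s^ k) a)))      ≡⟨ cong (s ∘ s) (height-s^ k a) ⟩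
    s (s ((s^ (k * 2)) (height tgt a))) ∎

  Vtx : Set
  Vtx = Vertex (suc (h * 2)) (suc n * 2)

  row : V → Row
  row (x , c , a) = (s^ toℕ c) (height x a)

  φ : V → Vtx
  φ v@(x , c , a) = c , row v

  unpack : Fin (suc (h * 2)) → Fin (suc n) × Fin 2 → V
  unpack c (a , b) = side b , c , a

  ψ : Vtx → V
  ψ (c , j) = unpack c (remQuot 2 (Twist.K⁻ (s-power (toℕ c)) j))

  side-bit : ∀ x → side (bit x) ≡ x
  side-bit src = refl
  side-bit tgt = refl

  bit-side : ∀ b → bit (side b) ≡ b
  bit-side zero       = refl
  bit-side (suc zero) = refl

  ψ-φ : ∀ v → ψ (φ v) ≡ v
  ψ-φ (x , c , a) = begin
    unpack c (remQuot 2 (Twist.K⁻ (s-power (toℕ c)) (row (x , c , a))))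
      ≡⟨ cong (λ j → unpack c (remQuot 2 j)) (Twist.K⁻-K (s-power (toℕ c)) (height x a)) ⟩
    unpack c (remQuot 2 (combine a (bit x)))
      ≡⟨ cong (unpack c) (Fin.remQuot-combine a (bit x)) ⟩
    side (bit x) , c , a
      ≡⟨ cong (_, c , a) (side-bit x) ⟩
    x , c , a ∎

  φ-ψ : ∀ w → φ (ψ w) ≡ w
  φ-ψ (c , j) = cong (c ,_) (begin
    (s^ toℕ c) (combine a (bit (side b))) ≡⟨ cong (λ b → (s^ toℕ c) (combine a b)) (bit-side b) ⟩
    (s^ toℕ c) (combine a b)              ≡⟨ cong (s^ toℕ c) (Fin.combine-remQuot 2 j′) ⟩
    (s^ toℕ c) j′                         ≡⟨ Twist.K-K⁻ (s-power (toℕ c)) j ⟩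
    j                                     ∎)
    where
    j′ : Row
    j′ = Twist.K⁻ (s-power (toℕ c)) j
    a : Fin (suc n)
    a = proj₁ (remQuot {suc n} 2 j′)
    b : Fin 2
    b = proj₂ (remQuot {suc n} 2 j′)

  φ-injective : ∀ {v w} → φ v ≡ φ w → v ≡ w
  φ-injective {v} {w} eq = trans (sym (ψ-φ v)) (trans (cong ψ eq) (ψ-φ w))

  -- Wrapping round subtracts multiples of the even column length, which keeps the parity of c + (c
  -- + 2a + bit). Thus flat edges and jumps start exactly at sources.
  parity : ∀ x c a → (toℕ c + toℕ (row (x , c , a))) % 2 ≡ toℕ (bit x)
  parity x c a with q , eq ← s^-wraps (toℕ c) (height x a) = begin
    (i + j) % 2                               ≡⟨ [m+kn]%n≡m%n (i + j) (q * suc n) 2 ⟨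
    (i + j + q * suc n * 2) % 2               ≡⟨ cong (_% 2) (regroup i j q (suc n)) ⟩
    (i + (j + q * (suc n * 2))) % 2           ≡⟨ cong (λ t → (i + t) % 2) eq ⟨
    (i + (i + toℕ (height x a))) % 2          ≡⟨ cong (λ t → (i + (i + t)) % 2) (toℕ-height x a) ⟩
    (i + (i + (2 * toℕ a + toℕ (bit x)))) % 2 ≡⟨ cong (_% 2) (double i (toℕ a) (toℕ (bit x))) ⟩
    (toℕ (bit x) + (i + toℕ a) * 2) % 2       ≡⟨ [m+kn]%n≡m%n (toℕ (bit x)) (i + toℕ a) 2 ⟩
    toℕ (bit x) % 2                           ≡⟨ m<n⇒m%n≡m (Fin.toℕ<n (bit x)) ⟩
    toℕ (bit x)                               ∎
    where
    i j : ℕ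
    i = toℕ c
    j = toℕ (row (x , c , a))
    regroup : ∀ i j q N → i + j + q * N * 2 ≡ i + (j + q * (N * 2))
    regroup = solve-∀
    double : ∀ i a b → i + (i + (2 * a + b)) ≡ b + (i + a) * 2
    double = solve-∀

  row-α : ∀ c a → row (src , c , a) ≡ s (row (tgt , c , a))
  row-α c a = trans (cong (s^ toℕ c) (height-src a)) (Twist.K-s (s-power (toℕ c)) (height tgt a))

  row-β : ∀ c a → row (tgt , c , s a) ≡ s (row (src , c , a))
  row-β c a = trans (cong (s^ toℕ c) (height-tgt a)) (Twist.K-s (s-power (toℕ c)) (height src a))

  row-γ : ∀ c a → row (tgt , suc c , a) ≡ row (src , inject₁ c , a)
  row-γ c a = begin
    s ((s^ toℕ c) (height tgt a))              ≡⟨ Twist.K-s (s-power (toℕ c)) (height tgt a) ⟨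
    (s^ toℕ c) (s (height tgt a))              ≡⟨ cong (s^ toℕ c) (height-src a) ⟨
    (s^ toℕ c) (height src a)                  ≡⟨ cong (λ k → (s^ k) (height src a)) (Fin.toℕ-inject₁ c) ⟨
    (s^ toℕ (inject₁ c)) (height src a)        ∎

  -- Both sides are 2a + 2h + 4 modulo the column length: twice the twist h + 2 is the jump 3, plus
  -- the shear 2h of the last column, plus the offset 1 of a source.
  row-wrap : ∀ a → row (tgt , zero , Twist.K τ a) ≡ (s^ 3) (row (src , fromℕ (h * 2) , a))
  row-wrap a = begin
    height tgt ((s^ (2 + h)) a)                        ≡⟨ height-s^ (2 + h) a ⟩
    s (s (s (s ((s^ (h * 2)) (height tgt a)))))        ≡⟨ cong (s ∘ s ∘ s) (Twist.K-s (s-power (h * 2)) (height tgt a)) ⟨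
    (s^ 3) ((s^ (h * 2)) (s (height tgt a)))           ≡⟨ cong (λ t → (s^ 3) ((s^ (h * 2)) t)) (height-src a) ⟨
    (s^ 3) ((s^ (h * 2)) (height src a))               ≡⟨ cong (λ k → (s^ 3) ((s^ k) (height src a))) (Fin.toℕ-fromℕ (h * 2)) ⟨
    (s^ 3) (row (src , fromℕ (h * 2) , a))             ∎

  Fwd : Vtx → Vtx → Set
  Fwd = Forward (suc (h * 2)) (suc n * 2) 3

  HTG : Vtx → Vtx → Set
  HTG = HTGAdj (suc (h * 2)) (suc n * 2) 3

  upward : ∀ c {x y a b} → row (y , c , b) ≡ s (row (x , c , a)) → Fwd (φ (x , c , a)) (φ (y , c , b))
  upward c {x} {y} {a} eq = inj₁ (refl , subst (λ j → CongMod (suc n * 2) (toℕ j) _) (sym eq) (congMod-s^ 1 (row (x , c , a))))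

  last-row-parity : ∀ x a → toℕ (row (x , fromℕ (h * 2) , a)) % 2 ≡ toℕ (bit x)
  last-row-parity x a = begin
    j % 2                            ≡⟨ [m+kn]%n≡m%n j h 2 ⟨
    (j + h * 2) % 2                  ≡⟨ cong (_% 2) (ℕ.+-comm j (h * 2)) ⟩
    (h * 2 + j) % 2                  ≡⟨ cong (λ t → (t + j) % 2) (Fin.toℕ-fromℕ (h * 2)) ⟨
    (toℕ (fromℕ (h * 2)) + j) % 2    ≡⟨ parity x (fromℕ (h * 2)) a ⟩
    toℕ (bit x)                      ∎
    where
    j : ℕ
    j = toℕ (row (x , fromℕ (h * 2) , a))

  columns-odd : suc (h * 2) % 2 ≡ 1
  columns-odd = [m+kn]%n≡m%n 1 h 2

  forward-γ : ∀ c a → Fwd (φ (src , c , a)) (φ (nbr γ (src , c , a)))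
  forward-γ c a with view c
  ... | ‵fromℕ     = inj₂ (inj₂ (cong suc (Fin.toℕ-fromℕ (h * 2)) , refl , trans (last-row-parity src a) (sym columns-odd) ,
                       subst (λ j → CongMod (suc n * 2) (toℕ j) (toℕ (row (src , fromℕ (h * 2) , a)) + 3)) (sym (row-wrap a)) (congMod-s^ 3 (row (src , fromℕ (h * 2) , a)))))
  ... | ‵inject₁ j = inj₂ (inj₁ (sym (cong toℕ (row-γ j a)) , cong suc (Fin.toℕ-inject₁ j) , parity src (inject₁ j) a))

  nbr-forward : ∀ d x → Fwd (φ (src , x)) (φ (nbr d (src , x))) ⊎ Fwd (φ (nbr d (src , x))) (φ (src , x))
  nbr-forward α (c , a) = inj₂ (upward c {tgt} {src} {a} {a} (row-α c a))
  nbr-forward β (c , a) = inj₁ (upward c {src} {tgt} {a} {s a} (row-β c a))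
  nbr-forward γ (c , a) = inj₁ (forward-γ c a)

  adj⁺-src : ∀ d x → HTG (φ (src , x)) (φ (nbr d (src , x))) × HTG (φ (nbr d (src , x))) (φ (src , x))
  adj⁺-src d x with nbr-forward d x
  ... | inj₁ f = forward⇒adj _ _ _ (≢ ∘ sym) f , backward⇒adj _ _ _ ≢ f
    where
    ≢ : φ (nbr d (src , x)) ≢ φ (src , x)
    ≢ eq = nbr-irrefl d (src , x) (φ-injective eq)
  ... | inj₂ f = backward⇒adj _ _ _ (≢ ∘ sym) f , forward⇒adj _ _ _ ≢ f
    where
    ≢ : φ (nbr d (src , x)) ≢ φ (src , x)
    ≢ eq = nbr-irrefl d (src , x) (φ-injective eq)

  adj⁺ : ∀ {v w} → Adj v w → HTG (φ v) (φ w)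
  adj⁺ {src , x} (d , refl) = proj₁ (adj⁺-src d x)
  adj⁺ {v@(tgt , x)} (d , refl) = subst (λ u → HTG (φ u) (φ (nbr d v))) (nbr-invol d v) (proj₂ (adj⁺-src d (from d x)))

  nbr-above : ∀ v → ∃ λ w → Adj v w × column (h * 2) τ w ≡ column (h * 2) τ v × row w ≡ s (row v)
  nbr-above (src , c , a) = _ , (β , refl) , refl , row-β c a
  nbr-above (tgt , c , a) = _ , (α , refl) , refl , row-α c a

  forward⇒adj⁻ : ∀ {v w} → Fwd (φ v) (φ w) → Adj v w
  forward⇒adj⁻ {v} {w} (inj₁ (eq , c)) with u , a , col , r ← nbr-above v =
    subst (Adj v) (φ-injective (cong₂ _,_ (trans col (Fin.toℕ-injective eq)) (trans r (sym (congMod⇒≡s^ 1 (row v) (row w) c))))) a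
  forward⇒adj⁻ {tgt , c , a} (inj₂ (inj₁ (_ , _ , odd))) with () ← trans (sym (parity tgt c a)) odd
  forward⇒adj⁻ {src , c , a} {w} (inj₂ (inj₁ (rows , cols , _))) = γ , sym (φ-injective flat)
    where
    flat : φ (nbr γ (src , c , a)) ≡ φ w
    flat with view c
    ... | ‵fromℕ     = ⊥-elim (ℕ.<-irrefl (trans (sym cols) (cong suc (Fin.toℕ-fromℕ (h * 2)))) (Fin.toℕ<n (proj₁ (φ w))))
    ... | ‵inject₁ j = cong₂ _,_ (Fin.toℕ-injective (trans (cong suc (sym (Fin.toℕ-inject₁ j))) cols))
                                 (trans (row-γ j a) (Fin.toℕ-injective rows))
  forward⇒adj⁻ {x , c , a} {w} (inj₂ (inj₂ (last , first , odd , cong3)))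
    with refl ← Fin.toℕ-injective {i = c} {fromℕ (h * 2)} (trans (ℕ.suc-injective last) (sym (Fin.toℕ-fromℕ (h * 2)))) = jump x odd cong3
    where
    jump : ∀ x → toℕ (row (x , fromℕ (h * 2) , a)) % 2 ≡ suc (h * 2) % 2 →
      CongMod (suc n * 2) (toℕ (row w)) (toℕ (row (x , fromℕ (h * 2) , a)) + 3) → Adj (x , fromℕ (h * 2) , a) w
    jump tgt odd _ with () ← trans (sym (last-row-parity tgt a)) (trans odd columns-odd)
    jump src _ c = γ , sym (φ-injective (begin
      φ (nbr γ (src , fromℕ (h * 2) , a))                  ≡⟨ cong (λ y → φ (tgt , y)) (hop-fromℕ (h * 2) τ a) ⟩
      zero , row (tgt , zero , Twist.K τ a)                ≡⟨ cong (zero ,_) (row-wrap a) ⟩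
      zero , (s^ 3) (row (src , fromℕ (h * 2) , a))        ≡⟨ cong₂ _,_ (sym (Fin.toℕ-injective first)) (sym (congMod⇒≡s^ 3 _ (row w) c)) ⟩
      φ w                                                  ∎))

  adj⁻ : ∀ {v w} → HTG (φ v) (φ w) → Adj v w
  adj⁻ a with adj⇒forward _ _ _ a
  ... | inj₁ f = forward⇒adj⁻ f
  ... | inj₂ f = adj-sym (forward⇒adj⁻ f)

  cyclable⇔allSeparable : Simple → TwoSpanningCyclable HTG ⇔ AllSeparable (Torus (h * 2) τ)
  cyclable⇔allSeparable simple = Realisation.cyclable⇔allSeparable (Torus (h * 2) τ) simple (Checker._≟ᵛ_ (h * 2) τ)
    HTG φ ψ φ-ψ ψ-φ adj⁺ adj⁻ (λ (i , j) → combine i j)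
    λ {(i , j)} {(i′ , j′)} eq → let p , q = Fin.combine-injective i j i′ j′ eq in cong₂ _,_ p q

-- Exceptional tori

α≢β : α ≢ β
α≢β ()

α≢γ : α ≢ γ
α≢γ ()

β≢γ : β ≢ γ
β≢γ ()

-- If the source a and the target a + 1 lie on different cycles, then so do the source a + 1 and the
-- target a + 2, and the colours of the sources alternate.
¬allSeparable-one-column : ∀ n → even n ≡ true → ¬ AllSeparable (Torus 0 {n} (s-power 2))
¬allSeparable-one-column n n-even all
  with F , u≢v ← all (src , zero , zero) (tgt , zero , s zero) (λ ()) = contradiction F u≢v
  where
  module _ (F : TwoCycles (Torus 0 {n} (s-power 2))) where
    open Graph (Torus 0 {n} (s-power 2))
    open TwoCycles F
    Split : Fin (suc n) → Set
    Split a = colour (src , zero , a) ≢ colour (tgt , zero , s a)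
    omits-β : ∀ a → Split a → omit (src , zero , a) ≡ β
    omits-β a split with β ≟ᵈ omit (src , zero , a)
    ... | yes eq = sym eq
    ... | no β≢  = ⊥-elim (split (sym (colour-nbr _ β β≢)))
    next : ∀ a → Split a → colour (src , zero , s a) ≡ colour (tgt , zero , s a)
    next a split = colour-nbr (tgt , zero , s a) α λ eq → α≢β (trans eq (omit-partner F (omits-β a split)))
    split-s : ∀ a → Split a → Split (s a)
    split-s a split eq = split (trans (sym (colour-nbr (src , zero , a) γ λ eq → β≢γ (sym (trans eq (omits-β a split)))))
                                      (trans (sym eq) (next a split)))
    contradiction : Split zero → ⊥
    contradiction split₀ = Bool.not-¬ {colour (src , zero , zero)} refl (trans (sym (at-top)) flip-top)
      where
      split : ∀ a → Split a
      split = cyclic-induction Split split₀ split-s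
      flip : ∀ a → colour (src , zero , s a) ≡ not (colour (src , zero , a))
      flip a = trans (next a (split a)) (Bool.¬-not (split a ∘ sym))
      alternate : ∀ a → colour (src , zero , a) ≡ (if even (toℕ a) then colour (src , zero , zero) else not (colour (src , zero , zero)))
      alternate = <-weakInduction _ refl λ j ih → begin
        colour (src , zero , suc j)               ≡⟨ cong (λ a → colour (src , zero , a)) (s-inject₁ j) ⟨
        colour (src , zero , s (inject₁ j))       ≡⟨ flip (inject₁ j) ⟩
        not (colour (src , zero , inject₁ j))     ≡⟨ cong not ih ⟩
        not (if even (toℕ (inject₁ j)) then c else not c) ≡⟨ cong (λ k → not (if even k then c else not c)) (Fin.toℕ-inject₁ j) ⟩
        not (if even (toℕ j) then c else not c)   ≡⟨ not-if (even (toℕ j)) c ⟩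
        (if not (even (toℕ j)) then c else not c) ∎
        where
        c : Bool
        c = colour (src , zero , zero)
        not-if : ∀ b c → not (if b then c else not c) ≡ (if not b then c else not c)
        not-if true  c = refl
        not-if false c = Bool.not-involutive c
      -- The number n + 1 of rows is odd, so alternation gives the top row the colour of row 0,
      -- although row 0 is its cyclic successor.
      at-top : colour (src , zero , fromℕ n) ≡ colour (src , zero , zero)
      at-top = trans (alternate (fromℕ n)) (cong (λ b → if b then colour (src , zero , zero) else not (colour (src , zero , zero)))
        (trans (cong even (Fin.toℕ-fromℕ n)) n-even))
      flip-top : colour (src , zero , fromℕ n) ≡ not (colour (src , zero , zero))
      flip-top = trans (sym (Bool.not-involutive _)) (cong not (trans (sym (flip (fromℕ n))) (cong (λ a → colour (src , zero , a)) (s-fromℕ n))))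

-- If the cut in front of column 0 is crossed just once, then every column carries a path from one
-- cut to the next, so that a single cycle meets all of them.
module SingleCrossing {m : ℕ} {τ : Twist 1} (F : TwoCycles (Torus m τ)) where
  open Graph (Torus m τ)
  open TwoCycles F

  two-rows : ∀ (t a : Fin 2) → a ≡ t ⊎ a ≡ s t
  two-rows zero       zero       = inj₁ refl
  two-rows zero       (suc zero) = inj₂ refl
  two-rows (suc zero) zero       = inj₂ refl
  two-rows (suc zero) (suc zero) = inj₁ refl

  s-s : ∀ (t : Fin 2) → s (s t) ≡ t
  s-s zero       = refl
  s-s (suc zero) = refl

  p≡s : ∀ (t : Fin 2) → p t ≡ s t
  p≡s zero       = refl
  p≡s (suc zero) = refl

  record Path (c : Fin (suc m)) (k : Bool) : Set where
    field
      column-colour : ∀ x a → colour (x , c , a) ≡ k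
      exit          : Fin 2
      exit-used     : omit (src , c , exit) ≢ γ
      exit-unused   : omit (src , c , s exit) ≡ γ

  -- With two rows the `α` and `β` edges of a column form a 4-cycle. Target `t` keeps both of its
  -- edges there, while target `s t` omits one; this opens the 4-cycle into a path through all four
  -- vertices, whose other end is a source that leaves by `γ`.
  path : ∀ c t → omit (tgt , c , t) ≡ γ → omit (tgt , c , s t) ≢ γ → Path c (colour (tgt , c , s t))
  path c t γ-t γ≢t′ with omit (tgt , c , s t) in eq
  ... | γ = ⊥-elim (γ≢t′ refl)
  ... | α = record { column-colour = column-colour ; exit = s t
                   ; exit-used = λ eq′ → α≢γ (trans (sym (omit-partner F eq)) eq′)
                   ; exit-unused = trans (cong (λ a → omit (src , c , a)) (s-s t)) omit-src }
    where
    omit-src : omit (src , c , t) ≡ γ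
    omit-src with omit (src , c , t) in eq′
    ... | α = trans (sym (omit-partner F eq′)) γ-t
    ... | β with () ← trans (sym (omit-partner F eq′)) eq
    ... | γ = refl
    at-src-t : colour (src , c , t) ≡ colour (tgt , c , s t)
    at-src-t = sym (colour-nbr (src , c , t) β λ eq′ → β≢γ (trans eq′ omit-src))
    at-tgt-t : colour (tgt , c , t) ≡ colour (tgt , c , s t)
    at-tgt-t = trans (sym (colour-nbr (tgt , c , t) α λ eq′ → α≢γ (trans eq′ γ-t))) at-src-t
    at-src-s : colour (src , c , s t) ≡ colour (tgt , c , s t)
    at-src-s = trans (cong (λ a → colour (src , c , a)) (sym (p≡s t)))
                 (trans (colour-nbr (tgt , c , t) β λ eq′ → β≢γ (trans eq′ γ-t)) at-tgt-t)
    column-colour : ∀ x a → colour (x , c , a) ≡ colour (tgt , c , s t)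
    column-colour x a with two-rows t a
    column-colour src _ | inj₁ refl = at-src-t
    column-colour tgt _ | inj₁ refl = at-tgt-t
    column-colour src _ | inj₂ refl = at-src-s
    column-colour tgt _ | inj₂ refl = refl
  ... | β = record { column-colour = column-colour ; exit = t
                   ; exit-used = λ eq′ → β≢γ (trans (sym omit-src-t) eq′) ; exit-unused = omit-src }
    where
    omit-src-t : omit (src , c , t) ≡ β
    omit-src-t = trans (cong (λ a → omit (src , c , a)) (sym (p-s t))) (omit-partner F eq)
    omit-src : omit (src , c , s t) ≡ γ
    omit-src with omit (src , c , s t) in eq′
    ... | α with () ← trans (sym (omit-partner F eq′)) eq
    ... | β = trans (sym (omit-partner F eq′)) (trans (cong (λ a → omit (tgt , c , a)) (s-s t)) γ-t)
    ... | γ = refl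
    at-src-s : colour (src , c , s t) ≡ colour (tgt , c , s t)
    at-src-s = colour-nbr (tgt , c , s t) α λ eq′ → α≢β (trans eq′ eq)
    at-tgt-t : colour (tgt , c , t) ≡ colour (tgt , c , s t)
    at-tgt-t = trans (sym (colour-nbr (tgt , c , t) β λ eq′ → β≢γ (trans eq′ γ-t)))
                 (trans (cong (λ a → colour (src , c , a)) (p≡s t)) at-src-s)
    at-src-t : colour (src , c , t) ≡ colour (tgt , c , s t)
    at-src-t = trans (colour-nbr (tgt , c , t) α λ eq′ → α≢γ (trans eq′ γ-t)) at-tgt-t
    column-colour : ∀ x a → colour (x , c , a) ≡ colour (tgt , c , s t)
    column-colour x a with two-rows t a
    column-colour src _ | inj₁ refl = at-src-t
    column-colour tgt _ | inj₁ refl = at-tgt-t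
    column-colour src _ | inj₂ refl = at-src-s
    column-colour tgt _ | inj₂ refl = refl

  path-next : ∀ {k} c → Path (inject₁ c) k → Path (suc c) k
  path-next {k} c P = subst (Path (suc c)) colour-exit (path (suc c) (s exit)
      (trans (cong (λ x → omit (tgt , x)) (sym (hop-inject₁ m τ c (s exit)))) (omit-partner F exit-unused))
      (λ eq → exit-used (omit-partner F (trans (cong (λ a → omit (tgt , suc c , a)) (sym (s-s exit))) eq))))
    where
    open Path P
    colour-exit : colour (tgt , suc c , s (s exit)) ≡ k
    colour-exit = begin
      colour (tgt , suc c , s (s exit))               ≡⟨ cong (λ a → colour (tgt , suc c , a)) (s-s exit) ⟩
      colour (tgt , suc c , exit)                     ≡⟨ cong (λ x → colour (tgt , x)) (hop-inject₁ m τ c exit) ⟨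
      colour (nbr γ (src , inject₁ c , exit))         ≡⟨ colour-nbr (src , inject₁ c , exit) γ (exit-used ∘ sym) ⟩
      colour (src , inject₁ c , exit)                 ≡⟨ column-colour src exit ⟩
      k                                               ∎

  monochromatic : ∀ t → omit (tgt , zero , t) ≡ γ → omit (tgt , zero , s t) ≢ γ → ∀ v w → colour v ≡ colour w
  monochromatic t γ-t γ≢ (x , c , a) (y , d , b) =
    trans (Path.column-colour (paths c) x a) (sym (Path.column-colour (paths d) y b))
    where
    paths : ∀ c → Path c (colour (tgt , zero , s t))
    paths = <-weakInduction _ (path zero t γ-t γ≢) path-next

-- Separating the ends of a `γ` edge over the cut forces its omission. The cut is still crossed,
-- hence in the other row only, and then everything lies on one cycle.
¬allSeparable-two-rows : ∀ m (τ : Twist 1) → ¬ AllSeparable (Torus (2 + m) τ)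
¬allSeparable-two-rows m τ all
  with F , u≢v ← all (tgt , zero , zero) (Graph.nbr (Torus (2 + m) τ) γ (tgt , zero , zero)) (λ ()) = contradiction F u≢v
  where
  open Graph (Torus (2 + m) τ)
  contradiction : (F : TwoCycles (Torus (2 + m) τ)) →
    TwoCycles.colour F (tgt , zero , zero) ≢ TwoCycles.colour F (nbr γ (tgt , zero , zero)) → ⊥
  contradiction F u≢v = go (cut-is-crossed F)
    where
    open TwoCycles F
    omits-γ : omit (tgt , zero , zero) ≡ γ
    omits-γ with γ ≟ᵈ omit (tgt , zero , zero)
    ... | yes eq = sym eq
    ... | no γ≢  = ⊥-elim (u≢v (sym (colour-nbr _ γ γ≢)))
    go : (∃ λ b → omit (tgt , zero , b) ≢ γ) → ⊥
    go (zero , γ≢)     = γ≢ omits-γ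
    go (suc zero , γ≢) = u≢v (SingleCrossing.monochromatic F zero omits-γ γ≢ _ _)

-- HTG(3, 6, 3) is the Pappus graph; the complement of each of its perfect matchings has one or three
-- components.
module PappusGraph where
  open Graph (Torus 2 {2} (s-power 3))
  module C = Checker 2 {2} (s-power 3)

  at : Fin 3 → Fin 3 → V
  at c a = src , c , a

  Column : Set
  Column = Vec Dir 3

  allColumns? : {P : Column → Set} → (∀ c → Dec (P c)) → Dec (∀ c → P c)
  allColumns? P? = map′ (λ { f (d ∷ e ∷ g ∷ []) → f d e g }) (λ f d e g → f (d ∷ e ∷ g ∷ []))
    (allDirs? λ d → allDirs? λ e → allDirs? λ g → P? (d ∷ e ∷ g ∷ []))

  -- Both sources would be matched with target `s a`. Discarding such columns one at a time keeps
  -- the search far below all 27 · 27 · 27 tables.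
  Clash : Column → Set
  Clash column = ∃ λ a → lookup column a ≡ β × lookup column (s a) ≡ α

  clash? : ∀ column → Dec (Clash column)
  clash? column = Fin.any? λ a → (lookup column a ≟ᵈ β) ×-dec (lookup column (s a) ≟ᵈ α)

  -- Invariance is demanded for two of the three representatives only, because the third is merely
  -- tested against these two.
  ThreeCycles : Table 2 2 → Set
  ThreeCycles T = C.Invariant T C.root × ∃ λ c → ∃ λ a → C.onCycleOf T C.root (at c a) ≡ false × C.Invariant T (at c a) ×
    ∃ λ c′ → ∃ λ a′ → C.onCycleOf T C.root (at c′ a′) ≡ false × C.onCycleOf T (at c a) (at c′ a′) ≡ false

  threeCycles? : ∀ T → Dec (ThreeCycles T)
  threeCycles? T = C.invariant? T C.root ×-dec Fin.any? λ c → Fin.any? λ a →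
    (C.onCycleOf T C.root (at c a) Bool.≟ false) ×-dec C.invariant? T (at c a) ×-dec Fin.any? λ c′ → Fin.any? λ a′ →
    (C.onCycleOf T C.root (at c′ a′) Bool.≟ false) ×-dec (C.onCycleOf T (at c a) (at c′ a′) Bool.≟ false)

  NotTwoCycles : Table 2 2 → Set
  NotTwoCycles T = ¬ C.Consistent T ⊎ (∀ v → C.onCycleOf T C.root v ≡ true) ⊎ ThreeCycles T

  notTwoCycles? : ∀ T → Dec (NotTwoCycles T)
  notTwoCycles? T = ¬? (C.consistent? T) ⊎-dec C.allVertices? (λ v → C.onCycleOf T C.root v Bool.≟ true) ⊎-dec threeCycles? T

  exhaustive : ∀ c₀ → Clash c₀ ⊎ (∀ c₁ → Clash c₁ ⊎ (∀ c₂ → Clash c₂ ⊎ NotTwoCycles (c₀ ∷ c₁ ∷ c₂ ∷ [])))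
  exhaustive = from-yes (allColumns? λ c₀ → clash? c₀ ⊎-dec allColumns? λ c₁ → clash? c₁ ⊎-dec
    allColumns? λ c₂ → clash? c₂ ⊎-dec notTwoCycles? (c₀ ∷ c₁ ∷ c₂ ∷ []))

  no-twoCycles : (F : TwoCycles (Torus 2 {2} (s-power 3))) → ∀ {u v} → TwoCycles.colour F u ≡ TwoCycles.colour F v
  no-twoCycles F {u} {v} = conclude (exhaustive (column′ zero))
    where
    open TwoCycles F
    column′ : Fin 3 → Column
    column′ c = omit (at c zero) ∷ omit (at c (suc zero)) ∷ omit (at c (suc (suc zero))) ∷ []
    T : Table 2 2
    T = column′ zero ∷ column′ (suc zero) ∷ column′ (suc (suc zero)) ∷ []
    lookup-column : ∀ c a → lookup (column′ c) a ≡ omit (at c a)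
    lookup-column c zero             = refl
    lookup-column c (suc zero)       = refl
    lookup-column c (suc (suc zero)) = refl
    lookup-T : ∀ c → lookup T c ≡ column′ c
    lookup-T zero             = refl
    lookup-T (suc zero)       = refl
    lookup-T (suc (suc zero)) = refl
    omit-src : ∀ x → C.omit T (src , x) ≡ omit (src , x)
    omit-src (c , a) = trans (cong (λ column → lookup column a) (lookup-T c)) (lookup-column c a)
    -- The table stores sources only; at a target it reads off the source matched to it, and `F`
    -- agrees since its omitted edges form a matching.
    omit-≡ : ∀ w → C.omit T w ≡ omit w
    omit-≡ (src , x) = omit-src x
    omit-≡ (tgt , x) with C.omit T (src , from α x) ≟ᵈ α | C.omit T (src , from β x) ≟ᵈ β
    ... | yes eq | _      = sym (omit-partner F (trans (sym (omit-src (from α x))) eq))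
    ... | no _   | yes eq = sym (trans (cong (λ y → omit (tgt , y)) (sym (to-from β x)))
                                       (omit-partner F (trans (sym (omit-src (from β x))) eq)))
    ... | no ≢α  | no ≢β with omit (tgt , x) in eq
    ...   | α = ⊥-elim (≢α (trans (omit-src (from α x)) (omit-partner F eq)))
    ...   | β = ⊥-elim (≢β (trans (omit-src (from β x)) (omit-partner F eq)))
    ...   | γ = refl
    consistent : C.Consistent T
    consistent w = trans (omit-≡ _) (trans (cong (λ d → omit (nbr d w)) (omit-≡ w)) (trans (omit-nbr w) (sym (omit-≡ w))))
    from-T : ∀ {w w′} → Linked (C.omit T) w w′ → Linked omit w w′
    from-T = gmap id λ { (use d d≢) → use d λ eq → d≢ (trans eq (sym (omit-≡ _))) }
    to-T : ∀ {w w′} → Linked omit w w′ → Linked (C.omit T) w w′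
    to-T = gmap id λ { (use d d≢) → use d λ eq → d≢ (trans eq (omit-≡ _)) }
    no-clash : ∀ c → ¬ Clash (column′ c)
    no-clash c (a , isβ , isα) = α≢β (trans
      (sym (omit-partner F (trans (sym (lookup-column c (s a))) isα)))
      (omit-partner F (trans (sym (lookup-column c a)) isβ)))
    on-root : ∀ r → C.onCycleOf T r r ≡ true
    on-root r with r C.≟ᵛ r
    ... | yes _ = refl
    ... | no r≢ = ⊥-elim (r≢ refl)
    distinct : ∀ {r r′} → C.Invariant T r → C.onCycleOf T r r′ ≡ false → colour r ≢ colour r′
    distinct {r} {r′} inv off eq with () ← trans (sym (on-root r)) (trans
      (colour-invariant (C.omit T) (C.onCycleOf T r) (C.invariant-nbr T {r} inv) (to-T (linked r r′ eq))) off)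
    not-two : NotTwoCycles T → colour u ≡ colour v
    not-two (inj₁ inconsistent) = ⊥-elim (inconsistent consistent)
    not-two (inj₂ (inj₁ one)) = trans (to-root u) (sym (to-root v))
      where
      to-root : ∀ w → colour w ≡ colour C.root
      to-root w = linked-colour (from-T (C.onCycleOf-sound T (one w)))
    not-two (inj₂ (inj₂ (inv , c , a , off , inv′ , c′ , a′ , off′ , off″))) =
      ⊥-elim (three (bool-pigeonhole (colour C.root) (colour (at c a)) (colour (at c′ a′))))
      where
      three : _ → ⊥
      three (inj₁ eq)        = distinct inv off eq
      three (inj₂ (inj₁ eq)) = distinct inv′ off″ eq
      three (inj₂ (inj₂ eq)) = distinct inv off′ eq
    conclude : _ → colour u ≡ colour v
    conclude (inj₁ clash) = ⊥-elim (no-clash _ clash)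
    conclude (inj₂ f) with f (column′ (suc zero))
    ... | inj₁ clash = ⊥-elim (no-clash _ clash)
    ... | inj₂ f′ with f′ (column′ (suc (suc zero)))
    ...   | inj₁ clash = ⊥-elim (no-clash _ clash)
    ...   | inj₂ x     = not-two x

  ¬allSeparable : ¬ AllSeparable (Torus 2 {2} (s-power 3))
  ¬allSeparable all with F , u≢v ← all (at zero zero) (at zero (suc zero)) (λ ()) = u≢v (no-twoCycles F)

-- Case distinction by the numbers of columns and rows

Condition : ℕ → ℕ → Set
Condition m n = (m ≡ 1 × n % 4 ≡ 0 × 6 < n) ⊎ (5 ≤ m × n ≡ 6) ⊎ (3 ≤ m × 8 ≤ n)

¬⇔¬ : {A B : Set} → ¬ A → ¬ B → A ⇔ B
¬⇔¬ ¬a ¬b = mk⇔ (⊥-elim ∘ ¬a) (⊥-elim ∘ ¬b)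

double-%4 : ∀ k → suc k * 2 % 4 ≡ (if even k then 2 else 0)
double-%4 zero          = refl
double-%4 (suc zero)    = refl
double-%4 (suc (suc k)) = begin
  (4 + suc k * 2) % 4                          ≡⟨ cong (_% 4) (ℕ.+-comm 4 (suc k * 2)) ⟩
  (suc k * 2 + 4) % 4                          ≡⟨ [m+n]%n≡m%n (suc k * 2) 4 ⟩
  suc k * 2 % 4                                ≡⟨ double-%4 k ⟩
  (if even k then 2 else 0)                    ≡⟨ cong (λ b → if b then 2 else 0) (Bool.not-involutive (even k)) ⟨
  (if not (not (even k)) then 2 else 0)        ∎

-- Two disjoint cycles need six vertices, and there are four. The torus is bypassed because with two
-- rows the twist is the identity, which makes `α` and `γ` parallel.
¬cyclable-4-cycle : ¬ TwoSpanningCyclable (HTGAdj 1 4 3)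
¬cyclable-4-cycle cyc
  with cyc (zero , zero) (zero , suc zero) (λ ())
... | C₁@(_ ∷ _) , C₂@(_ ∷ _) , ((len₁ , u₁ , _) , (len₂ , u₂ , _) , _ , disjoint) , _ =
  ℕ.<⇒≱ {4} (s≤s (s≤s (s≤s (s≤s (s≤s z≤n))))) (ℕ.≤-trans (ℕ.+-mono-≤ len₁ len₂)
    (subst (_≤ 4) (List.length-++ C₁) (unique⇒length≤ proj₂ (λ { {zero , _} {zero , _} refl → refl })
      (Unique.++⁺ u₁ u₂ λ (x∈₁ , x∈₂) → disjoint _ x∈₁ x∈₂))))

characterisation : ∀ h n → TwoSpanningCyclable (HTGAdj (suc (h * 2)) (suc (suc n) * 2) 3) ⇔ Condition (suc (h * 2)) (suc (suc n) * 2)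
characterisation zero zero = ¬⇔¬ ¬cyclable-4-cycle λ
  { (inj₁ (_ , _ , s≤s (s≤s (s≤s (s≤s ()))))) ; (inj₂ (inj₁ (s≤s () , _))) ; (inj₂ (inj₂ (s≤s () , _))) }
characterisation zero (suc n) with even n in eq
... | true = ¬⇔¬ (λ cyc → ¬allSeparable-one-column (2 + n) (trans (Bool.not-involutive _) eq) (Equivalence.to equivalence cyc)) λ
  { (inj₁ (_ , %4 , _)) → 2≢0 (trans (sym (trans (double-%4 (2 + n)) (cong (λ b → if b then 2 else 0) (trans (Bool.not-involutive _) eq)))) %4)
  ; (inj₂ (inj₁ (s≤s () , _))) ; (inj₂ (inj₂ (s≤s () , _))) }
  where
  2≢0 : 2 ≢ 0
  2≢0 ()
  equivalence = HTG.cyclable⇔allSeparable 0 (2 + n) (simple-one-column n)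
-- Since `even zero` is `true`, the argument is a successor here; so there are at least four rows,
-- which yields the bound 6.
characterisation zero (suc (suc n)) | false =
  mk⇔ (λ _ → inj₁ (refl , trans (double-%4 (3 + n)) (cong (λ b → if b then 2 else 0) (trans (Bool.not-involutive _) eq)) , ℕ.m≤m+n 7 (suc (n * 2))))
      (λ _ → Equivalence.from (HTG.cyclable⇔allSeparable 0 (3 + n) (simple-one-column (suc n)))
               (allSeparable-one-column n (trans (Bool.not-involutive _) eq)))
characterisation (suc h) zero = ¬⇔¬
  (λ cyc → ¬allSeparable-two-rows (h * 2) _ (Equivalence.to (HTG.cyclable⇔allSeparable (suc h) 1 (simple-torus (suc (h * 2)) _)) cyc)) λ
  { (inj₂ (inj₂ (_ , s≤s (s≤s (s≤s (s≤s ())))))) }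
characterisation (suc zero) (suc zero) = ¬⇔¬
  (λ cyc → PappusGraph.¬allSeparable (Equivalence.to (HTG.cyclable⇔allSeparable 1 2 (simple-torus 1 _)) cyc)) λ
  { (inj₂ (inj₁ (s≤s (s≤s (s≤s ())) , _))) ; (inj₂ (inj₂ (_ , s≤s (s≤s (s≤s (s≤s (s≤s (s≤s ())))))))) }
characterisation (suc (suc h)) (suc zero) = mk⇔
  (λ _ → inj₂ (inj₁ (ℕ.m≤m+n 5 (h * 2) , refl)))
  (λ _ → Equivalence.from (HTG.cyclable⇔allSeparable (2 + h) 2 (simple-torus (3 + h * 2) _)) (allSeparable-3-rows (1 + h * 2) _))
characterisation (suc h) (suc (suc n)) = mk⇔
  (λ _ → inj₂ (inj₂ (ℕ.m≤m+n 3 (h * 2) , ℕ.m≤m+n 8 (n * 2))))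
  (λ _ → Equivalence.from (HTG.cyclable⇔allSeparable (suc h) (3 + n) (simple-torus (suc (h * 2)) _)) (allSeparable-odd-columns h n))

theorem4p2 : (m n : ℕ) → m % 2 ≡ 1 → 4 ≤ n → n % 2 ≡ 0 →
    (TwoSpanningCyclable (HTGAdj m n 3)
    ⇔ ((m ≡ 1 × n % 4 ≡ 0 × 6 < n) ⊎ (5 ≤ m × n ≡ 6) ⊎ (3 ≤ m × 8 ≤ n)))
theorem4p2 m n m-odd 4≤n n-even = go (m / 2) (n / 2) m≡ n≡ 4≤n
  where
  m≡ : m ≡ suc (m / 2 * 2)
  m≡ = trans (m≡m%n+[m/n]*n m 2) (cong (_+ m / 2 * 2) m-odd)
  n≡ : n ≡ n / 2 * 2
  n≡ = trans (m≡m%n+[m/n]*n n 2) (cong (_+ n / 2 * 2) n-even)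
  go : ∀ h k → m ≡ suc (h * 2) → n ≡ k * 2 → 4 ≤ n → TwoSpanningCyclable (HTGAdj m n 3) ⇔ Condition m n
  go h zero refl refl ()
  go h (suc zero) refl refl (s≤s (s≤s ()))
  go h (suc (suc k)) refl refl _ = characterisation h k
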